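{- Let $w_1,w_2,w_3$ be positive integers such that $r$ divides none of $w_1,w_2,w_3$. Then for every integer $n\ge 0$, as an identity of polynomials in $y$, $$\begin{aligned} &\sum_{k+l+m=n}\binom{n}{k,l,m}B_{k,\chi,\xi^{w_3}}(w_1y)\,B_{l,\chi,\xi^{w_1}}(w_2y)\,B_{m,\chi,\xi^{w_2}}(w_3y)\,w_3^{k}w_1^{l}w_2^{m}\\ &=\sum_{k+l+m=n}\binom{n}{k,l,m}B_{k,\chi,\xi^{w_2}}(w_1y)\,B_{l,\chi,\xi^{w_1}}(w_3y)\,B_{m,\chi,\xi^{w_3}}(w_2y)\,w_2^{k}w_1^{l}w_3^{m}. \end{aligned}$$
   Context: Let $p$ be a prime, $\mathbb{C}_p$ the completion of an algebraic closure of $\mathbb{Q}_p$, $d$ a positive integer, and $\chi$ a primitive Dirichlet character of conductor $d$, with values viewed in $\mathbb{C}_p$ via a fixed embedding $\overline{\mathbb{Q}}\to\mathbb{C}_p$ (as usual $\chi(a)=0$ if $\gcd(a,d)>1$; for $d=1$, $\chi\equiv 1$). Let $r$ be a positive integer with $\gcd(r,pd)=1$ and let $\xi\neq 1$ in $\mathbb{C}_p$ be an $r$-th root of unity. For a root of unity $\eta\in\mathbb{C}_p$, the generalized twisted Bernoulli polynomials $B_{n,\chi,\eta}(x)$ attached to $\chi$ and $\eta$ are defined by the power series identity $$\frac{t\,e^{xt}}{\eta^{d}e^{dt}-1}\sum_{a=0}^{d-1}\chi(a)\eta^{a}e^{at}=\sum_{n=0}^{\infty}B_{n,\chi,\eta}(x)\frac{t^{n}}{n!}.$$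 (The left side is a power series in $t$ with coefficients in $\mathbb{C}_p[x]$, for any $\eta$.) Sums over $k+l+m=n$ run over all nonnegative integers $k,l,m$ with $k+l+m=n$, and $\binom{n}{k,l,m}=\frac{n!}{k!\,l!\,m!}$. -}

module Defs where

open import Level using (Level; _⊔_; 0ℓ) renaming (suc to lsuc)
open import Algebra.Bundles using (RawRing; CommutativeRing)
open import Algebra.Apartness.Bundles using (HeytingField; HeytingCommutativeRing)
open import Algebra.Morphism.Structures using (module RingMorphisms; module MonoidMorphisms)
import Algebra.Definitions.RawSemiring as RawSemiringDefinitions
open import Data.Fin.Base using (toℕ)
open import Data.Integer.Base as ℤ using (ℤ; +_; ∣_∣)
import Data.Integer.Coprimality as ℤ
import Data.Integer.Divisibility as ℤ
open import Data.List.Base using (List; []; _∷_; _++_; map; length; filter; upTo)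
open import Data.Nat.Base as ℕ using (ℕ; zero; suc; _∸_; _!)
open import Data.Nat.Divisibility as ℕ using (_∣?_)
open import Data.Nat.Properties using (_!≢0; m*n≢0)
open import Data.Product.Base using (∃; ∃₂; _×_; _,_)
open import Data.Rational.Base as ℚ using (ℚ; ↥_; ↧ₙ_)
import Data.Rational.Properties as ℚ
open import Function.Base using (_∘_; id)
open import Relation.Binary.PropositionalEquality.Core using (_≡_)
open import Relation.Nullary.Negation using (¬_)

private variable
  a ℓa ℓb c ℓ₁ ℓ₂ : Level

fieldRing : HeytingField c ℓ₁ ℓ₂ → RawRing c ℓ₁
fieldRing F = CommutativeRing.rawRing
  (HeytingCommutativeRing.commutativeRing (HeytingField.heytingCommutativeRing F))

------------------------------------------------------------------------
-- Polynomials and power series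

-- Polynomials in one variable as lists of coefficients, constant term
-- first; trailing zeros are allowed, so equality is coefficientwise.
module Polynomial (R : RawRing c ℓ₁) where
  open RawRing R

  coeff : List Carrier → ℕ → Carrier
  coeff []       _       = 0#
  coeff (x ∷ _)  zero    = x
  coeff (_ ∷ xs) (suc n) = coeff xs n

  _+ᴾ_ : List Carrier → List Carrier → List Carrier
  []       +ᴾ ys       = ys
  (x ∷ xs) +ᴾ []       = x ∷ xs
  (x ∷ xs) +ᴾ (y ∷ ys) = (x + y) ∷ (xs +ᴾ ys)

  _*ᴾ_ : List Carrier → List Carrier → List Carrier
  []       *ᴾ _  = []
  (x ∷ xs) *ᴾ ys = map (x *_) ys +ᴾ (0# ∷ (xs *ᴾ ys))

  const : Carrier → List Carrier
  const x = x ∷ []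

  rawRing : RawRing c ℓ₁
  rawRing = record
    { Carrier = List Carrier
    ; _≈_     = λ xs ys → ∀ n → coeff xs n ≈ coeff ys n
    ; _+_     = _+ᴾ_
    ; _*_     = _*ᴾ_
    ; -_      = map (-_)
    ; 0#      = []
    ; 1#      = const 1#
    }

-- The value at s of a polynomial over A, its coefficients being mapped
-- to the ring S by f.
evalVia : {A : Set a} (S : RawRing c ℓ₁) →
          (A → RawRing.Carrier S) → List A → RawRing.Carrier S → RawRing.Carrier S
evalVia S f []       s = RawRing.0# S
evalVia S f (x ∷ xs) s = f x + s * evalVia S f xs s
  where open RawRing S

module PowerSeries (R : RawRing c ℓ₁) where
  open RawRing R
  open RawSemiringDefinitions rawSemiring using (sum; _^_)

  Series : Set c
  Series = ℕ → Carrier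

  _*ˢ_ : Series → Series → Series
  (f *ˢ g) n = sum {suc n} (λ i → f (toℕ i) * g (n ∸ toℕ i))

  const : Carrier → Series
  const x zero    = x
  const x (suc _) = 0#

  t : Series
  t 1 = 1#
  t _ = 0#

  -- e^(x t), given the images in R of the numbers 1 / n!
  expWith : (ℕ → Carrier) → Carrier → Series
  expWith inv! x n = inv! n * x ^ n

  rawRing : RawRing c ℓ₁
  rawRing = record
    { Carrier = Series
    ; _≈_     = λ f g → ∀ n → f n ≈ g n
    ; _+_     = λ f g n → f n + g n
    ; _*_     = _*ˢ_
    ; -_      = λ f n → - f n
    ; 0#      = λ _ → 0#
    ; 1#      = const 1#
    }

------------------------------------------------------------------------
-- Algebraic closures and completions

module _ (F : HeytingField a ℓa ℓb) (K : HeytingField c ℓ₁ ℓ₂) where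
  private
    module F = HeytingField F
    module K = HeytingField K

  IsFieldHomomorphism : (F.Carrier → K.Carrier) → Set (a ⊔ ℓa ⊔ ℓ₁)
  IsFieldHomomorphism = RingMorphisms.IsRingHomomorphism (fieldRing F) (fieldRing K)

record AlgebraicClosure (F : HeytingField a ℓa ℓb) c ℓ₁ ℓ₂ :
                        Set (a ⊔ ℓa ⊔ ℓb ⊔ lsuc (c ⊔ ℓ₁ ⊔ ℓ₂)) where
  private module F = HeytingField F
  field
    closure : HeytingField c ℓ₁ ℓ₂
  open HeytingField closure
  field
    ι         : F.Carrier → Carrier
    ι-homo    : IsFieldHomomorphism F closure ι
    -- Every element is a root of a nonzero polynomial over F.
    algebraic : ∀ x → ∃₂ λ as b → (b F.# F.0#) ×
                evalVia (fieldRing closure) ι (as ++ b ∷ []) x ≈ 0#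
    -- Every nonconstant polynomial has a root.
    closed    : ∀ a as b → b # 0# → ∃ λ x →
                evalVia (fieldRing closure) id (a ∷ as ++ b ∷ []) x ≈ 0#

-- Absolute values are written additively, |x| = p ^ (- v x).  Rational
-- values are enough here: |ℂₚˣ| = p ^ ℚ.
Valuation : HeytingField c ℓ₁ ℓ₂ → Set (c ⊔ ℓ₂)
Valuation F = ∀ x → x # 0# → ℚ
  where open HeytingField F

module _ (F : HeytingField c ℓ₁ ℓ₂) (v : Valuation F) where
  open HeytingField F

  record IsValuation : Set (c ⊔ ℓ₁ ⊔ ℓ₂) where
    field
      v-cong  : ∀ x y x# y# → x ≈ y → v x x# ≡ v y y#
      v-*     : ∀ x y x# y# xy# → v (x * y) xy# ≡ v x x# ℚ.+ v y y#
      v-ultra : ∀ x y x# y# x+y# → v x x# ℚ.⊓ v y y# ℚ.≤ v (x + y) x+y#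

  -- |x - y| ≤ p ^ (- q)
  Close : ℚ → Carrier → Carrier → Set ℓ₂
  Close q x y = ∀ x-y# → q ℚ.≤ v (x - y) x-y#

  Cauchy : (ℕ → Carrier) → Set ℓ₂
  Cauchy s = ∀ q → ∃ λ N → ∀ m n → N ℕ.≤ m → N ℕ.≤ n → Close q (s m) (s n)

  _ConvergesTo_ : (ℕ → Carrier) → Carrier → Set ℓ₂
  s ConvergesTo x = ∀ q → ∃ λ N → ∀ n → N ℕ.≤ n → Close q (s n) x

  Complete : Set (c ⊔ ℓ₂)
  Complete = ∀ s → Cauchy s → ∃ (s ConvergesTo_)

module _ (F : HeytingField a ℓa ℓb) (v : Valuation F)
         (K : HeytingField c ℓ₁ ℓ₂) (w : Valuation K) where
  private
    module F = HeytingField F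
    module K = HeytingField K

  Extends : (F.Carrier → K.Carrier) → Set (a ⊔ ℓb ⊔ ℓ₂)
  Extends ι = ∀ x x# ιx# → w (ι x) ιx# ≡ v x x#

record Completion (F : HeytingField a ℓa ℓb) (v : Valuation F) c ℓ₁ ℓ₂ :
                  Set (a ⊔ ℓa ⊔ ℓb ⊔ lsuc (c ⊔ ℓ₁ ⊔ ℓ₂)) where
  private module F = HeytingField F
  field
    completion  : HeytingField c ℓ₁ ℓ₂
    v̂           : Valuation completion
    isValuation : IsValuation completion v̂
    ι           : F.Carrier → HeytingField.Carrier completion
    ι-homo      : IsFieldHomomorphism F completion ι
    isometric   : Extends F v completion v̂ ι
    dense       : ∀ y q → ∃ λ x → Close completion v̂ q y (ι x)
    complete    : Complete completion v̂

------------------------------------------------------------------------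
-- The field ℂₚ

ℚ-field : HeytingField 0ℓ 0ℓ 0ℓ
ℚ-field = ℚ.heytingField

-- The exponent of p in n ≥ 1, as the number of k ≥ 1 with pᵏ ∣ n
-- (all such k are at most n).
ord : ℕ → ℕ → ℕ
ord p n = length (filter (λ k → p ℕ.^ suc k ∣? n) (upTo n))

padic : ℕ → Valuation ℚ-field
padic p x _ = (+ ord p ∣ ↥ x ∣ ℤ.- + ord p (↧ₙ x)) ℚ./ 1

record ℂₚ-Tower (p : ℕ) c ℓ₁ ℓ₂ : Set (lsuc (c ⊔ ℓ₁ ⊔ ℓ₂)) where
  field
    completionℚ : Completion ℚ-field (padic p) c ℓ₁ ℓ₂

  module ℚₚ = Completion completionℚ

  field
    closureℚₚ   : AlgebraicClosure ℚₚ.completion c ℓ₁ ℓ₂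

  module ℚ̄ₚ = AlgebraicClosure closureℚₚ

  field
    v           : Valuation ℚ̄ₚ.closure
    isValuation : IsValuation ℚ̄ₚ.closure v
    v-extends   : Extends ℚₚ.completion ℚₚ.v̂ ℚ̄ₚ.closure v ℚ̄ₚ.ι
    completionℚ̄ₚ : Completion ℚ̄ₚ.closure v c ℓ₁ ℓ₂

  module ℂₚ = Completion completionℚ̄ₚ

  ℂₚ-field : HeytingField c ℓ₁ ℓ₂
  ℂₚ-field = ℂₚ.completion

  fromℚ : ℚ → HeytingField.Carrier ℂₚ-field
  fromℚ = ℂₚ.ι ∘ ℚ̄ₚ.ι ∘ ℚₚ.ι

------------------------------------------------------------------------
-- Dirichlet characters

record DirichletCharacter (K : HeytingField c ℓ₁ ℓ₂) (d : ℕ) : Set (c ⊔ ℓ₁) where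
  open HeytingField K using (Carrier; _≈_; 0#)
  field
    ⟦_⟧            : ℤ → Carrier
    multiplicative : MonoidMorphisms.IsMonoidHomomorphism
                       ℤ.*-1-rawMonoid (RawRing.*-rawMonoid (fieldRing K)) ⟦_⟧
    periodic       : ∀ a b → + d ℤ.∣ a ℤ.- b → ⟦ a ⟧ ≈ ⟦ b ⟧
    vanishes       : ∀ a → ¬ ℤ.Coprime a (+ d) → ⟦ a ⟧ ≈ 0#

-- The conductor of χ is d: χ is not induced by a character modulo a
-- proper divisor of d.
Primitive : (K : HeytingField c ℓ₁ ℓ₂) (d : ℕ) → DirichletCharacter K d → Set (c ⊔ ℓ₁)
Primitive K d χ = ∀ e → e ℕ.∣ d → (ψ : DirichletCharacter K e) →
                  (∀ a → ℤ.Coprime a (+ d) → χ.⟦ a ⟧ ≈ DirichletCharacter.⟦ ψ ⟧ a) → e ≡ d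
  where
  open HeytingField K using (_≈_)
  module χ = DirichletCharacter χ

------------------------------------------------------------------------
-- Twisted Bernoulli polynomials

1/! : ℕ → ℚ
1/! n = ((+ 1) ℚ./ (n !)) {{n !≢0}}

trinomial : ℕ → ℕ → ℕ → ℚ
trinomial k l m = ((+ ((k ℕ.+ l ℕ.+ m) !)) ℚ./ (k ! ℕ.* l ! ℕ.* m !)) {{nz}}
  where
  nz : ℕ.NonZero (k ! ℕ.* l ! ℕ.* m !)
  nz = m*n≢0 _ _ {{m*n≢0 _ _ {{k !≢0}} {{l !≢0}}}} {{m !≢0}}

module Bernoulli {p : ℕ} (T : ℂₚ-Tower p c ℓ₁ ℓ₂) where
  open ℂₚ-Tower T public using (ℂₚ-field; fromℚ)

  K : RawRing c ℓ₁
  K = fieldRing ℂₚ-field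

  module K where
    open RawRing K public
    open RawSemiringDefinitions rawSemiring public using (_^_)

  fromℕ : ℕ → K.Carrier
  fromℕ n = fromℚ (+ n ℚ./ 1)

  K[x] : RawRing c ℓ₁
  K[x] = Polynomial.rawRing K

  module K[x] where
    open RawRing K[x] public
    open RawSemiringDefinitions rawSemiring public using (sum)
    open Polynomial K public using (const)

  Poly : Set c
  Poly = K[x].Carrier

  x : Poly
  x = K.0# ∷ K.1# ∷ []

  infixl 8 _at_·y
  -- P(w y), as a polynomial in y
  _at_·y : Poly → ℕ → Poly
  P at w ·y = evalVia K[x] K[x].const P (K[x].const (fromℕ w) K[x].* x)

  K[x]⟦t⟧ : RawRing c ℓ₁
  K[x]⟦t⟧ = PowerSeries.rawRing K[x]

  module K[x]⟦t⟧ where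
    open RawRing K[x]⟦t⟧ public
    open RawSemiringDefinitions rawSemiring public using (sum)
    open PowerSeries K[x] public using (Series; const; t; expWith)

  scalar : K.Carrier → K[x]⟦t⟧.Series
  scalar = K[x]⟦t⟧.const ∘ K[x].const

  inv! : ℕ → Poly
  inv! n = K[x].const (fromℚ (1/! n))

  exp : Poly → K[x]⟦t⟧.Series
  exp = K[x]⟦t⟧.expWith inv!

  -- The quotient that generates the B_{n,χ,η} is the solution G of
  --   (η^d e^(dt) - 1) G = t e^(xt) Σ χ(a) η^a e^(at).
  -- The first factor is not zero, so G is unique; its order in t is at
  -- most 1, so it divides the right side and G exists for every η.
  IsTwistedBernoulli : (d : ℕ) (χ : ℤ → K.Carrier) (η : K.Carrier) →
                       (B : ℕ → Poly) → Set ℓ₁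
  IsTwistedBernoulli d χ η B =
    (scalar (η K.^ d) * exp (K[x].const (fromℕ d)) + - 1#) * (λ n → B n K[x].* inv! n)
      ≈ t * exp x * sum {d} (λ i → let a = toℕ i in
          scalar (χ (+ a) K.* η K.^ a) * exp (K[x].const (fromℕ a)))
    where open K[x]⟦t⟧

  -- The sum of f k l m over all k + l + m = n
  ∑₃ : ℕ → (ℕ → ℕ → ℕ → Poly) → Poly
  ∑₃ n f = K[x].sum {suc n} λ i → let k = toℕ i in
           K[x].sum {suc (n ∸ k)} λ j → let l = toℕ j in
           f k l (n ∸ k ∸ l)

{-# OPTIONS --safe #-}
module Submission where

open import Defs
open import Level using (Level; _⊔_)
open import Algebra.Apartness.Bundles using (HeytingField; HeytingCommutativeRing)
open import Algebra.Bundles using (RawRing; CommutativeMonoid; CommutativeRing; Semiring)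
open import Algebra.Morphism.Structures using (module RingMorphisms)
import Algebra.Definitions.RawSemiring as RawSemiringDefinitions
import Algebra.Morphism.Construct.Composition as Composition
import Algebra.Morphism.RingMonomorphism as RingMonomorphism
import Algebra.Properties.CommutativeMonoid.Mult as Mult
import Algebra.Properties.CommutativeSemigroup as CommutativeSemigroup
import Algebra.Properties.CommutativeSemiring.Exp as Exp
import Algebra.Properties.Group as GroupProperties
import Algebra.Properties.Ring as RingProperties
import Algebra.Properties.Semiring.Sum as Sum
import Algebra.Solver.CommutativeMonoid as CommutativeMonoidSolver
open import Data.Fin.Base using (Fin; zero; suc; toℕ)
open import Data.Fin.Patterns using (0F; 1F; 2F)
import Data.Fin.Properties as Fin
open import Data.Integer.Base as ℤ using (+_)
import Data.Integer.Properties as ℤ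
open import Data.List.Base using (List; []; _∷_; map)
open import Data.Nat.Base as ℕ using (ℕ; zero; suc; NonZero; _∸_; _≤_; _<_; _!)
open import Data.Nat.Coprimality using (Coprime)
open import Data.Nat.Divisibility using (_∤_)
import Data.Nat.Induction as ℕ
open import Data.Nat.Primality using (Prime)
import Data.Nat.Properties as ℕ
open import Data.Nat.Tactic.RingSolver using (solve-∀)
open import Data.Product.Base using (_,_)
open import Data.Rational.Base as ℚ using (ℚ)
import Data.Rational.Properties as ℚ
open import Data.Rational.Unnormalised.Base as ℚᵘ using (mkℚᵘ; *≡*)
import Data.Rational.Unnormalised.Properties as ℚᵘ
open import Function.Base using (_∘_; it)
open import Relation.Binary.PropositionalEquality as ≡ using (_≡_)
import Relation.Binary.Reasoning.Setoid as ≈-Reasoning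
open import Relation.Nullary.Negation using (¬_)

-- The series Σ B_{n,χ,ξ^u}(w y) (u t)ⁿ / n! has the form T e^(u w y t) S / D, where T, S
-- and D = ξ^(u d) e^(d u t) - 1 depend on u only.  The exponential is symmetric in u and
-- w, so the two products of three such series agree once multiplied by D₁ D₂ D₃.  Each D
-- can be cancelled, even where its constant term may vanish: D h = 0 says that h is fixed
-- by ξ^(u d) e^(d u t), hence also by the r-th power e^(r d u t), whose lowest
-- nonconstant coefficient is invertible.

-- The obstacle is cancelling D. When r is composite, ξ may have order smaller than r, so ξ^(u d)
-- can equal 1 although r does not divide u; and deciding whether it does would mean deciding
-- equality in ℂₚ. The r-th power avoids the case distinction: whatever ξ^(u d) is, it disappears,
-- the constant term becomes exactly 1, and the coefficient of t becomes r d u, a nonzero rational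
-- whose inverse can be written down in ℚ and carried into the coefficient ring K[x]. Write (a, b)
-- for the series with twist and scaling of t by w_a and argument w_b y. The left side multiplies
-- (3,1), (1,2), (2,3) and the right side (2,1), (1,3), (3,2): the same cycle with every arrow
-- reversed. This is why symmetry of the exponential in its two weights settles the identity.

private variable
  c c′ ℓ ℓ′ ℓ₁ ℓ₂ : Level

-- Commutative rings: elements fixed by a multiplication, and cancellation

module RingLemmas (R : CommutativeRing c ℓ) where
  open CommutativeRing R
  open Exp commutativeSemiring
  open RingProperties ring using (-1*x≈-x)
  open GroupProperties +-group using (x∙y⁻¹≈ε⇒x≈y)
  open ≈-Reasoning setoid

  ^-fixes : ∀ {x y} → x * y ≈ y → ∀ n → x ^ n * y ≈ y
  ^-fixes         x*y≈y zero    = *-identityˡ _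
  ^-fixes {x} {y} x*y≈y (suc n) = begin
    x * x ^ n * y    ≈⟨ *-assoc _ _ _ ⟩
    x * (x ^ n * y)  ≈⟨ *-congˡ (^-fixes x*y≈y n) ⟩
    x * y            ≈⟨ x*y≈y ⟩
    y                ∎

  [x-1]y≈0⇒xy≈y : ∀ x y → (x + - 1#) * y ≈ 0# → x * y ≈ y
  [x-1]y≈0⇒xy≈y x y eq = x∙y⁻¹≈ε⇒x≈y _ _ (begin
    x * y + - y         ≈⟨ +-congˡ (-1*x≈-x y) ⟨
    x * y + - 1# * y    ≈⟨ distribʳ y x (- 1#) ⟨
    (x + - 1#) * y      ≈⟨ eq ⟩
    0#                  ∎)

  [zx-1]y≈0⇒xⁿy≈y : ∀ z x y n → z ^ n ≈ 1# → (z * x + - 1#) * y ≈ 0# → x ^ n * y ≈ y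
  [zx-1]y≈0⇒xⁿy≈y z x y n zⁿ≈1 eq = begin
    x ^ n * y            ≈⟨ *-congʳ (*-identityˡ _) ⟨
    1# * x ^ n * y       ≈⟨ *-congʳ (*-congʳ zⁿ≈1) ⟨
    z ^ n * x ^ n * y    ≈⟨ *-congʳ (^-distrib-* z x n) ⟨
    (z * x) ^ n * y      ≈⟨ ^-fixes ([x-1]y≈0⇒xy≈y (z * x) y eq) n ⟩
    y                    ∎

  -- Only the annihilator is required to vanish; `cancelˡ` recovers cancellation by applying this to
  -- a difference.
  Cancellable : Carrier → Set (c ⊔ ℓ)
  Cancellable x = ∀ y → x * y ≈ 0# → y ≈ 0#

-- Formal power series over a commutative ring

module SeriesProperties (R : CommutativeRing c ℓ) where
  open CommutativeRing R
  open PowerSeries rawRing using (Series; _*ˢ_; const) renaming (rawRing to rawRingˢ)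
  open RawRing rawRingˢ using () renaming (_≈_ to _≈ˢ_; _+_ to _+ˢ_)
  open CommutativeSemigroup (CommutativeMonoid.commutativeSemigroup +-commutativeMonoid)
    using (interchange)
  open RingLemmas using (Cancellable)
  open ≈-Reasoning setoid

  -- By computation `(f *ˢ g) (suc n)` is `f 0 * g (suc n) + (tail f *ˢ g) n`. The laws of the
  -- product are therefore proved by induction on the index with `f` varying, without reindexing any
  -- sum.
  tail : Series → Series
  tail f n = f (suc n)

  *ˢ-cong : ∀ {f g h k} → f ≈ˢ g → h ≈ˢ k → f *ˢ h ≈ˢ g *ˢ k
  *ˢ-cong p q zero    = +-congʳ (*-cong (p 0) (q 0))
  *ˢ-cong p q (suc n) = +-cong (*-cong (p 0) (q (suc n))) (*ˢ-cong (p ∘ suc) q n)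

  *ˢ-zeroˡ : ∀ f g → (∀ n → f n ≈ 0#) → ∀ n → (f *ˢ g) n ≈ 0#
  *ˢ-zeroˡ f g f≈0 zero    = trans (+-identityʳ _) (trans (*-congʳ (f≈0 0)) (zeroˡ _))
  *ˢ-zeroˡ f g f≈0 (suc n) = trans (+-cong (trans (*-congʳ (f≈0 0)) (zeroˡ _))
    (*ˢ-zeroˡ (tail f) g (f≈0 ∘ suc) n)) (+-identityʳ _)

  *ˢ-distribʳ : ∀ h f g → (f +ˢ g) *ˢ h ≈ˢ (f *ˢ h) +ˢ (g *ˢ h)
  *ˢ-distribʳ h f g zero    = begin
    (f 0 + g 0) * h 0 + 0#               ≈⟨ +-cong (distribʳ _ _ _) (sym (+-identityʳ 0#)) ⟩
    (f 0 * h 0 + g 0 * h 0) + (0# + 0#)  ≈⟨ interchange _ _ _ _ ⟩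
    (f 0 * h 0 + 0#) + (g 0 * h 0 + 0#)  ∎
  *ˢ-distribʳ h f g (suc n) = trans
    (+-cong (distribʳ _ _ _) (*ˢ-distribʳ h (tail f) (tail g) n)) (interchange _ _ _ _)

  *ˢ-scaleˡ : ∀ x f g n → ((λ i → x * f i) *ˢ g) n ≈ x * (f *ˢ g) n
  *ˢ-scaleˡ x f g zero    = begin
    x * f 0 * g 0 + 0#         ≈⟨ +-cong (*-assoc _ _ _) (sym (zeroʳ x)) ⟩
    x * (f 0 * g 0) + x * 0#   ≈⟨ distribˡ _ _ _ ⟨
    x * (f 0 * g 0 + 0#)       ∎
  *ˢ-scaleˡ x f g (suc n) = trans
    (+-cong (*-assoc _ _ _) (*ˢ-scaleˡ x (tail f) g n)) (sym (distribˡ _ _ _))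

  *ˢ-assoc : ∀ f g h → (f *ˢ g) *ˢ h ≈ˢ f *ˢ (g *ˢ h)
  *ˢ-assoc f g h zero = +-congʳ (begin
    (f 0 * g 0 + 0#) * h 0    ≈⟨ *-congʳ (+-identityʳ _) ⟩
    f 0 * g 0 * h 0           ≈⟨ *-assoc _ _ _ ⟩
    f 0 * (g 0 * h 0)         ≈⟨ *-congˡ (+-identityʳ _) ⟨
    f 0 * (g 0 * h 0 + 0#)    ∎)
  *ˢ-assoc f g h (suc n) = begin
    -- The tail of `f *ˢ g` is, again by computation, `f 0` times `tail g` plus `tail f *ˢ g`, so
    -- the induction hypothesis is needed for `tail f` only.
    (f 0 * g 0 + 0#) * h (suc n) + (((λ i → f 0 * g (suc i)) +ˢ (tail f *ˢ g)) *ˢ h) n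
      ≈⟨ +-cong (trans (*-congʳ (+-identityʳ _)) (*-assoc _ _ _))
           (*ˢ-distribʳ h (λ i → f 0 * g (suc i)) (tail f *ˢ g) n) ⟩
    f 0 * (g 0 * h (suc n)) + (((λ i → f 0 * g (suc i)) *ˢ h) n + ((tail f *ˢ g) *ˢ h) n)
      ≈⟨ +-assoc _ _ _ ⟨
    (f 0 * (g 0 * h (suc n)) + ((λ i → f 0 * g (suc i)) *ˢ h) n) + ((tail f *ˢ g) *ˢ h) n
      ≈⟨ +-cong (+-congˡ (*ˢ-scaleˡ (f 0) (tail g) h n)) (*ˢ-assoc (tail f) g h n) ⟩
    (f 0 * (g 0 * h (suc n)) + f 0 * (tail g *ˢ h) n) + (tail f *ˢ (g *ˢ h)) n
      ≈⟨ +-congʳ (distribˡ _ _ _) ⟨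
    f 0 * (g 0 * h (suc n) + (tail g *ˢ h) n) + (tail f *ˢ (g *ˢ h)) n ∎

  -- The defining recursion of the product peels off f 0; this one peels off g 0.
  *ˢ-sucʳ : ∀ f g n → (f *ˢ g) (suc n) ≈ f (suc n) * g 0 + (f *ˢ tail g) n
  *ˢ-sucʳ f g zero    = begin
    f 0 * g 1 + (f 1 * g 0 + 0#)  ≈⟨ +-assoc _ _ _ ⟨
    (f 0 * g 1 + f 1 * g 0) + 0#  ≈⟨ +-congʳ (+-comm _ _) ⟩
    (f 1 * g 0 + f 0 * g 1) + 0#  ≈⟨ +-assoc _ _ _ ⟩
    f 1 * g 0 + (f 0 * g 1 + 0#)  ∎
  *ˢ-sucʳ f g (suc n) = begin
    a + (tail f *ˢ g) (suc n)             ≈⟨ +-congˡ (*ˢ-sucʳ (tail f) g n) ⟩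
    a + (b + (tail f *ˢ tail g) n)        ≈⟨ +-assoc _ _ _ ⟨
    (a + b) + (tail f *ˢ tail g) n        ≈⟨ +-congʳ (+-comm _ _) ⟩
    (b + a) + (tail f *ˢ tail g) n        ≈⟨ +-assoc _ _ _ ⟩
    b + (a + (tail f *ˢ tail g) n)        ∎
    where
    a = f 0 * g (suc (suc n))
    b = f (suc (suc n)) * g 0

  *ˢ-comm : ∀ f g → f *ˢ g ≈ˢ g *ˢ f
  *ˢ-comm f g zero    = +-congʳ (*-comm _ _)
  *ˢ-comm f g (suc n) = trans (+-cong (*-comm _ _) (*ˢ-comm (tail f) g n)) (sym (*ˢ-sucʳ g f n))

  const-*ˢ : ∀ x f n → (const x *ˢ f) n ≈ x * f n
  const-*ˢ x f zero    = +-identityʳ _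
  const-*ˢ x f (suc n) = trans (+-congˡ (*ˢ-zeroˡ (tail (const x)) f (λ _ → refl) n)) (+-identityʳ _)

  commutativeRing : CommutativeRing c ℓ
  commutativeRing = record
    { RawRing rawRingˢ
    ; isCommutativeRing = record
      { isRing = record
        { +-isAbelianGroup = record
          { isGroup = record
            { isMonoid = record
              { isSemigroup = record
                { isMagma = record
                  { isEquivalence = record
                    { refl  = λ n → refl
                    ; sym   = λ p n → sym (p n)
                    ; trans = λ p q n → trans (p n) (q n)
                    }
                  ; ∙-cong = λ p q n → +-cong (p n) (q n)
                  }
                ; assoc = λ f g h n → +-assoc _ _ _
                }
              ; identity = (λ f n → +-identityˡ _) , (λ f n → +-identityʳ _)
              }
            ; inverse = (λ f n → -‿inverseˡ _) , (λ f n → -‿inverseʳ _)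
            ; ⁻¹-cong = λ p n → -‿cong (p n)
            }
          ; comm = λ f g n → +-comm _ _
          }
        ; *-cong = λ {f} {g} {h} {k} → *ˢ-cong {f} {g} {h} {k}
        ; *-assoc = *ˢ-assoc
        ; *-identity = identityˡ , λ f n → trans (*ˢ-comm f (const 1#) n) (identityˡ f n)
        ; distrib = (λ f g h n → trans (*ˢ-comm f (g +ˢ h) n) (trans (*ˢ-distribʳ f g h n)
                       (+-cong (*ˢ-comm g f n) (*ˢ-comm h f n))))
                  , *ˢ-distribʳ
        }
      ; *-comm = *ˢ-comm
      }
    }
    where
    identityˡ : ∀ f → const 1# *ˢ f ≈ˢ f
    identityˡ f n = trans (const-*ˢ 1# f n) (*-identityˡ _)

  module 𝕊 = CommutativeRing commutativeRing
  module 𝕊^ = Exp 𝕊.commutativeSemiring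
  open Exp commutativeSemiring using (_^_)
  open Mult +-commutativeMonoid using (_×_)

  const-^ : ∀ x n → const x 𝕊^.^ n ≈ˢ const (x ^ n)
  const-^ x zero    m = refl
  const-^ x (suc n) m = trans
    (*ˢ-cong {const x} {const x} {const x 𝕊^.^ n} {const (x ^ n)} (λ _ → refl) (const-^ x n) m)
    (trans (const-*ˢ x (const (x ^ n)) m) (lemma m))
    where
    lemma : ∀ m → x * const (x ^ n) m ≈ const (x * x ^ n) m
    lemma zero    = refl
    lemma (suc m) = zeroʳ x

  ^-coeff₀ : ∀ f → f 0 ≈ 1# → ∀ n → (f 𝕊^.^ n) 0 ≈ 1#
  ^-coeff₀ f f₀≈1 zero    = refl
  ^-coeff₀ f f₀≈1 (suc n) = trans (+-identityʳ _)
    (trans (*-cong f₀≈1 (^-coeff₀ f f₀≈1 n)) (*-identityˡ 1#))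

  -- Modulo t², (1 + a t)ⁿ is 1 + n a t.
  ^-coeff₁ : ∀ f → f 0 ≈ 1# → ∀ n → (f 𝕊^.^ n) 1 ≈ n × f 1
  ^-coeff₁ f f₀≈1 zero    = refl
  ^-coeff₁ f f₀≈1 (suc n) = begin
    f 0 * (f 𝕊^.^ n) 1 + (f 1 * (f 𝕊^.^ n) 0 + 0#)
      ≈⟨ +-cong (trans (*-congʳ f₀≈1) (*-identityˡ _)) (trans (+-identityʳ _)
           (trans (*-congˡ (^-coeff₀ f f₀≈1 n)) (*-identityʳ _))) ⟩
    (f 𝕊^.^ n) 1 + f 1  ≈⟨ +-congʳ (^-coeff₁ f f₀≈1 n) ⟩
    n × f 1 + f 1       ≈⟨ +-comm _ _ ⟩
    f 1 + n × f 1       ∎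

  *ˢ-lowest : ∀ f g n → (∀ {i} → i < n → g i ≈ 0#) → (f *ˢ g) n ≈ f 0 * g n
  *ˢ-lowest f g zero    g≈0 = +-identityʳ _
  *ˢ-lowest f g (suc n) g≈0 = begin
    f 0 * g (suc n) + (tail f *ˢ g) n    ≈⟨ +-congˡ (*ˢ-lowest (tail f) g n (g≈0 ∘ ℕ.m<n⇒m<1+n)) ⟩
    f 0 * g (suc n) + tail f 0 * g n     ≈⟨ +-congˡ (trans (*-congˡ (g≈0 ℕ.≤-refl)) (zeroʳ _)) ⟩
    f 0 * g (suc n) + 0#                 ≈⟨ +-identityʳ _ ⟩
    f 0 * g (suc n)                      ∎

  -- Since f - 1 is t times `tail f`, the hypothesis says that `tail f *ˢ g` vanishes, and `tail f`
  -- has the invertible constant term `f 1`. By strong induction the coefficients of `g` below n are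
  -- zero, so the n-th coefficient of that product is just `f 1 * g n`.
  fixed⇒zero : ∀ f g u → f 0 ≈ 1# → u * f 1 ≈ 1# → f *ˢ g ≈ˢ g → g ≈ˢ 𝕊.0#
  fixed⇒zero f g u f₀≈1 u*f₁≈1 fg≈g = ℕ.<-rec _ λ n rec → begin
    g n                ≈⟨ *-identityˡ _ ⟨
    1# * g n           ≈⟨ *-congʳ u*f₁≈1 ⟨
    u * f 1 * g n      ≈⟨ *-assoc _ _ _ ⟩
    u * (f 1 * g n)    ≈⟨ *-congˡ (*ˢ-lowest (tail f) g n rec) ⟨
    u * (tail f *ˢ g) n ≈⟨ *-congˡ (lemma n) ⟩
    u * 0#             ≈⟨ zeroʳ u ⟩
    0#                 ∎
    where
    open GroupProperties +-group using () renaming (∙-cancelˡ to +-cancelˡ)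
    lemma : ∀ n → (tail f *ˢ g) n ≈ 0#
    -- Coefficient `suc n` of f g = g is the one that involves `tail f` at n; its leading term
    -- `f 0 * g (suc n)` cancels against the right side because `f 0` is 1.
    lemma n = +-cancelˡ (g (suc n)) _ _ (begin
      g (suc n) + (tail f *ˢ g) n         ≈⟨ +-congʳ (trans (*-congʳ f₀≈1) (*-identityˡ _)) ⟨
      f 0 * g (suc n) + (tail f *ˢ g) n   ≈⟨ fg≈g (suc n) ⟩
      g (suc n)                           ≈⟨ +-identityʳ _ ⟨
      g (suc n) + 0#                      ∎)

  const-cong : ∀ {x y} → x ≈ y → const x ≈ˢ const y
  const-cong x≈y zero    = x≈y
  const-cong x≈y (suc n) = refl

  -- If (z e - 1) g = 0 and zʳ = 1 then eʳ g = (z e)ʳ g = g, so z drops out.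
  rootOfUnity-cancellable : ∀ e z u r → e 0 ≈ 1# → z ^ r ≈ 1# → u * (r × e 1) ≈ 1# →
                            Cancellable commutativeRing ((const z *ˢ e) +ˢ (𝕊.- 𝕊.1#))
  rootOfUnity-cancellable e z u r e₀≈1 zʳ≈1 u*re₁≈1 g eq =
    fixed⇒zero (e 𝕊^.^ r) g u (^-coeff₀ e e₀≈1 r)
      (trans (*-congˡ (^-coeff₁ e e₀≈1 r)) u*re₁≈1)
      ([zx-1]y≈0⇒xⁿy≈y (const z) e g r (λ n → trans (const-^ z r n) (const-cong zʳ≈1 n)) eq)
    where open RingLemmas commutativeRing using ([zx-1]y≈0⇒xⁿy≈y)

-- Ring homomorphisms and the maps of power series that they induce

module _ (R : RawRing c ℓ) (S : RawRing c′ ℓ′) where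
  private
    module R = RawRing R
    module S = RawRing S
  open RingMorphisms R S using (IsRingHomomorphism)

  ringHomomorphism : {φ : R.Carrier → S.Carrier} →
    (∀ {x y} → x R.≈ y → φ x S.≈ φ y) →
    (∀ x y → φ (x R.+ y) S.≈ φ x S.+ φ y) → φ R.0# S.≈ S.0# →
    (∀ x y → φ (x R.* y) S.≈ φ x S.* φ y) → φ R.1# S.≈ S.1# →
    (∀ x → φ (R.- x) S.≈ S.- φ x) → IsRingHomomorphism φ
  ringHomomorphism cong +-homo 0#-homo *-homo 1#-homo -‿homo = record
    { isSemiringHomomorphism = record
      { isNearSemiringHomomorphism = record
        { +-isMonoidHomomorphism = record
          { isMagmaHomomorphism = record
            { isRelHomomorphism = record { cong = cong }
            ; homo = +-homo
            }
          ; ε-homo = 0#-homo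
          }
        ; *-homo = *-homo
        }
      ; 1#-homo = 1#-homo
      }
    ; -‿homo = -‿homo
    }

module HomomorphismProperties (R : RawRing c ℓ) (S : CommutativeRing c′ ℓ′) where
  private
    module R where
      open RawRing R public
      open RawSemiringDefinitions rawSemiring public using (sum; _^_; _×_)
    module S where
      open CommutativeRing S public
      open RawSemiringDefinitions (Semiring.rawSemiring semiring) public using (sum; _^_; _×_)
  open RingMorphisms R S.rawRing using (IsRingHomomorphism)

  module _ {φ : R.Carrier → S.Carrier} (φ-homo : IsRingHomomorphism φ) where
    open IsRingHomomorphism φ-homo

    sum-homo : ∀ {n} (f : Fin n → R.Carrier) → φ (R.sum f) S.≈ S.sum (φ ∘ f)
    sum-homo {zero}  f = 0#-homo
    sum-homo {suc n} f = S.trans (+-homo _ _) (S.+-congˡ (sum-homo (f ∘ suc)))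

    ^-homo : ∀ x n → φ (x R.^ n) S.≈ φ x S.^ n
    ^-homo x zero    = 1#-homo
    ^-homo x (suc n) = S.trans (*-homo _ _) (S.*-congˡ (^-homo x n))

    ×-homo : ∀ n x → φ (n R.× x) S.≈ n S.× φ x
    ×-homo zero    x = 0#-homo
    ×-homo (suc n) x = S.trans (+-homo _ _) (S.+-congˡ (×-homo n x))

    -- The shapes here and in the next two lemmas are those of three rational identities (trinomial
    -- coefficient, product of weights, slope of the exponential) that are computed in ℚ and then
    -- transported to K[x].
    *-homo₄ : ∀ w x y z → φ (w R.* (x R.* (y R.* z))) S.≈ φ w S.* (φ x S.* (φ y S.* φ z))
    *-homo₄ w x y z = S.trans (*-homo _ _)
      (S.*-congˡ (S.trans (*-homo _ _) (S.*-congˡ (*-homo _ _))))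

    monomial-homo : ∀ x y z k l m →
      φ (x R.^ k R.* y R.^ l R.* z R.^ m) S.≈ φ x S.^ k S.* φ y S.^ l S.* φ z S.^ m
    monomial-homo x y z k l m = S.trans (*-homo _ _)
      (S.*-cong (S.trans (*-homo _ _) (S.*-cong (^-homo x k) (^-homo y l))) (^-homo z m))

    *×-homo : ∀ u n x y z →
      φ (u R.* (n R.× (x R.* y R.* z))) S.≈ φ u S.* (n S.× (φ x S.* φ y S.* φ z))
    *×-homo u n x y z = S.trans (*-homo _ _) (S.*-congˡ (S.trans (×-homo n _)
      (×-congʳ n (S.trans (*-homo _ _) (S.*-congʳ (*-homo _ _))))))
      where open Mult S.+-commutativeMonoid using (×-congʳ)

module SeriesHomomorphism (R : CommutativeRing c ℓ) (S : CommutativeRing c′ ℓ′) where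
  private
    module R = CommutativeRing R
    module S = CommutativeRing S
    module R⟦t⟧ where
      open PowerSeries R.rawRing public using (Series; const)
      open CommutativeRing (SeriesProperties.commutativeRing R) public
    module S⟦t⟧ where
      open PowerSeries S.rawRing public using (Series; const)
      open CommutativeRing (SeriesProperties.commutativeRing S) public
  open RingMorphisms R.rawRing S.rawRing using (IsRingHomomorphism)
  open CommutativeRing S
  open Exp commutativeSemiring using (_^_)
  open CommutativeSemigroup *-commutativeSemigroup using (interchange; x∙yz≈y∙xz)
  open ≈-Reasoning setoid

  -- The map f(t) to (φ f)(s t). With φ the substitution of w x for x and s = u, it turns the
  -- generating series in (x, t) into the one at (w y, u t).
  substitute : (R.Carrier → Carrier) → Carrier → R⟦t⟧.Series → S⟦t⟧.Series
  substitute φ s f n = φ (f n) * s ^ n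

  module _ {φ : R.Carrier → Carrier} (φ-homo : IsRingHomomorphism φ) (s : Carrier) where
    private
      module φ = IsRingHomomorphism φ-homo
      Φ = substitute φ s

    substitute-* : ∀ f g → Φ (f R⟦t⟧.* g) S⟦t⟧.≈ Φ f S⟦t⟧.* Φ g
    substitute-* f g zero = begin
      φ (f 0 R.* g 0 R.+ R.0#) * 1#             ≈⟨ *-identityʳ _ ⟩
      φ (f 0 R.* g 0 R.+ R.0#)                  ≈⟨ φ.⟦⟧-cong (R.+-identityʳ _) ⟩
      φ (f 0 R.* g 0)                           ≈⟨ φ.*-homo _ _ ⟩
      φ (f 0) * φ (g 0)                         ≈⟨ *-cong (*-identityʳ _) (*-identityʳ _) ⟨
      (φ (f 0) * 1#) * (φ (g 0) * 1#)           ≈⟨ +-identityʳ _ ⟨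
      (φ (f 0) * 1#) * (φ (g 0) * 1#) + 0#      ∎
    substitute-* f g (suc n) = begin
      φ (f 0 R.* g (suc n) R.+ (f′ R⟦t⟧.* g) n) * (s * s ^ n)
        ≈⟨ *-congʳ (trans (φ.+-homo _ _) (+-congʳ (φ.*-homo _ _))) ⟩
      (φ (f 0) * φ (g (suc n)) + φ ((f′ R⟦t⟧.* g) n)) * (s * s ^ n)
        ≈⟨ distribʳ _ _ _ ⟩
      φ (f 0) * φ (g (suc n)) * (s * s ^ n) + φ ((f′ R⟦t⟧.* g) n) * (s * s ^ n)
        -- The coefficient `f 0` carries no power of s, so all of s^(n+1) goes to `g (suc n)`. In
        -- the other summand one factor s is split off; it is what turns the image of `f′` into the
        -- tail of `Φ f`.
        ≈⟨ +-cong (trans (*-assoc _ _ _) (*-congʳ (sym (*-identityʳ _)))) (x∙yz≈y∙xz _ _ _) ⟩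
      (φ (f 0) * 1#) * (φ (g (suc n)) * (s * s ^ n)) + s * Φ (f′ R⟦t⟧.* g) n
        ≈⟨ +-congˡ (*-congˡ (substitute-* f′ g n)) ⟩
      (φ (f 0) * 1#) * (φ (g (suc n)) * (s * s ^ n)) + s * (Φ f′ S⟦t⟧.* Φ g) n
        ≈⟨ +-congˡ (*ˢ-scaleˡ s (Φ f′) (Φ g) n) ⟨
      (φ (f 0) * 1#) * (φ (g (suc n)) * (s * s ^ n)) + ((λ i → s * Φ f′ i) S⟦t⟧.* Φ g) n
        ≈⟨ +-congˡ (*ˢ-cong {λ i → s * Φ f′ i} {tail (Φ f)} {Φ g} {Φ g}
             (λ i → x∙yz≈y∙xz _ _ _) (λ _ → refl) n) ⟩
      (φ (f 0) * 1#) * (φ (g (suc n)) * (s * s ^ n)) + (tail (Φ f) S⟦t⟧.* Φ g) n ∎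
      where
      open SeriesProperties S using (*ˢ-scaleˡ; *ˢ-cong; tail)
      f′ : R⟦t⟧.Series
      f′ n = f (suc n)

    substitute-const : ∀ x → Φ (R⟦t⟧.const x) S⟦t⟧.≈ S⟦t⟧.const (φ x)
    substitute-const x zero    = *-identityʳ _
    substitute-const x (suc n) = trans (*-congʳ φ.0#-homo) (zeroˡ _)

    substitute-isRingHomomorphism :
      RingMorphisms.IsRingHomomorphism R⟦t⟧.rawRing S⟦t⟧.rawRing Φ
    substitute-isRingHomomorphism = ringHomomorphism R⟦t⟧.rawRing S⟦t⟧.rawRing
      (λ p n → *-congʳ (φ.⟦⟧-cong (p n)))
      (λ f g n → trans (*-congʳ (φ.+-homo _ _)) (distribʳ _ _ _))
      (λ n → trans (*-congʳ φ.0#-homo) (zeroˡ _))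
      substitute-*
      (λ n → trans (substitute-const R.1# n) (const-cong φ.1#-homo n))
      (λ f n → trans (*-congʳ (φ.-‿homo _)) (sym (-‿distribˡ-* _ _)))
      where
      open RingProperties ring using (-‿distribˡ-*)
      open SeriesProperties S using (const-cong)

-- Polynomials as coefficient lists, and their evaluation

module PolynomialProperties (R : CommutativeRing c ℓ) where
  open CommutativeRing R
  open Polynomial rawRing using (coeff; _+ᴾ_; _*ᴾ_; const) renaming (rawRing to rawRingᴾ)
  open PowerSeries rawRing using (_*ˢ_) renaming (const to constˢ)
  open RawRing rawRingᴾ using () renaming (_≈_ to _≈ᴾ_)
  open SeriesProperties R using (*ˢ-zeroˡ) renaming (commutativeRing to commutativeRingˢ)
  open ≈-Reasoning setoid

  coeff-+ : ∀ xs ys n → coeff (xs +ᴾ ys) n ≈ coeff xs n + coeff ys n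
  coeff-+ []       ys       n       = sym (+-identityˡ _)
  coeff-+ (x ∷ xs) []       n       = sym (+-identityʳ _)
  coeff-+ (x ∷ xs) (y ∷ ys) zero    = refl
  coeff-+ (x ∷ xs) (y ∷ ys) (suc n) = coeff-+ xs ys n

  coeff-map : ∀ {h} → h 0# ≈ 0# → ∀ xs n → coeff (map h xs) n ≈ h (coeff xs n)
  coeff-map h0≈0 []       n       = sym h0≈0
  coeff-map h0≈0 (x ∷ xs) zero    = refl
  coeff-map h0≈0 (x ∷ xs) (suc n) = coeff-map h0≈0 xs n

  coeff-* : ∀ xs ys n → coeff (xs *ᴾ ys) n ≈ (coeff xs *ˢ coeff ys) n
  coeff-* []       ys n       = sym (*ˢ-zeroˡ (coeff []) (coeff ys) (λ _ → refl) n)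
  coeff-* (x ∷ xs) ys zero    = trans (coeff-+ (map (x *_) ys) (0# ∷ (xs *ᴾ ys)) 0)
    (+-congʳ (coeff-map (zeroʳ x) ys 0))
  coeff-* (x ∷ xs) ys (suc n) = trans (coeff-+ (map (x *_) ys) (0# ∷ (xs *ᴾ ys)) (suc n))
    (+-cong (coeff-map (zeroʳ x) ys (suc n)) (coeff-* xs ys n))

  coeff-const : ∀ x n → coeff (const x) n ≈ constˢ x n
  coeff-const x zero    = refl
  coeff-const x (suc n) = refl

  coeff-neg : ∀ xs n → coeff (map -_ xs) n ≈ - coeff xs n
  coeff-neg = coeff-map -0#≈0#
    where open RingProperties ring using (-0#≈0#)

  -- Equality of lists is defined through `coeff`, so injectivity is immediate and the ring axioms
  -- for polynomials are pulled back from those for power series.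
  coeff-isRingMonomorphism :
    RingMorphisms.IsRingMonomorphism rawRingᴾ (CommutativeRing.rawRing commutativeRingˢ) coeff
  coeff-isRingMonomorphism = record
    { isRingHomomorphism = ringHomomorphism rawRingᴾ (CommutativeRing.rawRing commutativeRingˢ)
        (λ p → p) coeff-+ (λ _ → refl) coeff-* (coeff-const 1#) coeff-neg
    ; injective = λ p → p
    }

  commutativeRing : CommutativeRing c ℓ
  commutativeRing = record
    { RawRing rawRingᴾ
    ; isCommutativeRing = RingMonomorphism.isCommutativeRing coeff-isRingMonomorphism
        (CommutativeRing.isCommutativeRing commutativeRingˢ)
    }

  const-isRingHomomorphism : RingMorphisms.IsRingHomomorphism rawRing rawRingᴾ const
  const-isRingHomomorphism = ringHomomorphism rawRing rawRingᴾ
    (λ { x≈y zero → x≈y ; x≈y (suc n) → refl })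
    (λ { x y zero → refl ; x y (suc n) → refl })
    (λ { zero → refl ; (suc n) → refl })
    (λ { x y zero → sym (+-identityʳ _) ; x y (suc n) → refl })
    (λ n → refl)
    (λ { x zero → refl ; x (suc n) → refl })

  module Evaluation (S : CommutativeRing c′ ℓ′) {φ : Carrier → CommutativeRing.Carrier S}
    (φ-homo : RingMorphisms.IsRingHomomorphism rawRing (CommutativeRing.rawRing S) φ)
    (s : CommutativeRing.Carrier S) where
    private
      module S = CommutativeRing S
      module φ = RingMorphisms.IsRingHomomorphism φ-homo
      module S-Reasoning = ≈-Reasoning S.setoid

    eval : List Carrier → S.Carrier
    eval xs = evalVia S.rawRing φ xs s

    -- Equal polynomials may be lists of different lengths. This handles the surplus zeros when one
    -- list ends before the other in `eval-cong`.
    eval-zero : ∀ xs → (∀ n → coeff xs n ≈ 0#) → eval xs S.≈ S.0#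
    eval-zero []       _   = S.refl
    eval-zero (x ∷ xs) p = S.trans
      (S.+-cong (S.trans (φ.⟦⟧-cong (p 0)) φ.0#-homo)
                (S.trans (S.*-congˡ (eval-zero xs (p ∘ suc))) (S.zeroʳ s)))
      (S.+-identityʳ _)

    eval-cong : ∀ {xs ys} → xs ≈ᴾ ys → eval xs S.≈ eval ys
    eval-cong {[]}     {ys}     p = S.sym (eval-zero ys (λ n → sym (p n)))
    eval-cong {x ∷ xs} {[]}     p = eval-zero (x ∷ xs) p
    eval-cong {x ∷ xs} {y ∷ ys} p =
      S.+-cong (φ.⟦⟧-cong (p 0)) (S.*-congˡ (eval-cong {xs} {ys} (p ∘ suc)))

    eval-+ : ∀ xs ys → eval (xs +ᴾ ys) S.≈ eval xs S.+ eval ys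
    eval-+ []       ys       = S.sym (S.+-identityˡ _)
    eval-+ (x ∷ xs) []       = S.sym (S.+-identityʳ _)
    eval-+ (x ∷ xs) (y ∷ ys) = S.trans
      (S.+-cong (φ.+-homo x y) (S.trans (S.*-congˡ (eval-+ xs ys)) (S.distribˡ _ _ _)))
      (CommutativeSemigroup.interchange
        (CommutativeMonoid.commutativeSemigroup S.+-commutativeMonoid) _ _ _ _)

    eval-scale : ∀ x ys → eval (map (x *_) ys) S.≈ φ x S.* eval ys
    eval-scale x []       = S.sym (S.zeroʳ _)
    eval-scale x (y ∷ ys) = S.trans
      (S.+-cong (φ.*-homo x y) (S.trans (S.*-congˡ (eval-scale x ys))
        (CommutativeSemigroup.x∙yz≈y∙xz S.*-commutativeSemigroup _ _ _)))
      (S.sym (S.distribˡ _ _ _))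

    eval-* : ∀ xs ys → eval (xs *ᴾ ys) S.≈ eval xs S.* eval ys
    eval-* []       ys = S.sym (S.zeroˡ _)
    eval-* (x ∷ xs) ys = begin′
      eval (map (x *_) ys +ᴾ (0# ∷ (xs *ᴾ ys)))
        S-Reasoning.≈⟨ eval-+ (map (x *_) ys) (0# ∷ (xs *ᴾ ys)) ⟩
      eval (map (x *_) ys) S.+ (φ 0# S.+ s S.* eval (xs *ᴾ ys))
        S-Reasoning.≈⟨ S.+-cong (eval-scale x ys)
          (S.trans (S.+-congʳ φ.0#-homo) (S.+-identityˡ _)) ⟩
      φ x S.* eval ys S.+ s S.* eval (xs *ᴾ ys)
        S-Reasoning.≈⟨ S.+-congˡ (S.trans (S.*-congˡ (eval-* xs ys)) (S.sym (S.*-assoc _ _ _))) ⟩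
      φ x S.* eval ys S.+ s S.* eval xs S.* eval ys
        S-Reasoning.≈⟨ S.distribʳ _ _ _ ⟨
      (φ x S.+ s S.* eval xs) S.* eval ys S-Reasoning.∎
      where open S-Reasoning using () renaming (begin_ to begin′_)

    eval-const : ∀ x → eval (const x) S.≈ φ x
    eval-const x = S.trans (S.+-congˡ (S.zeroʳ s)) (S.+-identityʳ _)

    eval-var : eval (0# ∷ 1# ∷ []) S.≈ s
    eval-var = S.trans (S.+-cong φ.0#-homo (S.*-congˡ (S.trans (eval-const 1#) φ.1#-homo)))
      (S.trans (S.+-identityˡ _) (S.*-identityʳ s))

    eval-neg : ∀ xs → eval (map -_ xs) S.≈ S.- eval xs
    eval-neg []       = S.sym -0#≈0#
      where open RingProperties S.ring
    eval-neg (x ∷ xs) = S.trans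
      (S.+-cong (φ.-‿homo x) (S.trans (S.*-congˡ (eval-neg xs)) (S.sym (-‿distribʳ-* _ _))))
      (-‿+-comm _ _)
      where open RingProperties S.ring

    eval-isRingHomomorphism : RingMorphisms.IsRingHomomorphism rawRingᴾ S.rawRing eval
    eval-isRingHomomorphism = ringHomomorphism rawRingᴾ S.rawRing
      (λ {xs} {ys} → eval-cong {xs} {ys}) eval-+ S.refl eval-*
      (S.trans (eval-const 1#) φ.1#-homo) eval-neg

-- Arithmetic of fractions, factorials and trinomial coefficients

fromℚᵘ-homo-* : ∀ p q → ℚ.fromℚᵘ (p ℚᵘ.* q) ≡ ℚ.fromℚᵘ p ℚ.* ℚ.fromℚᵘ q
fromℚᵘ-homo-* p q = ℚ.toℚᵘ-injective (ℚᵘ.≃-trans (ℚ.toℚᵘ-fromℚᵘ (p ℚᵘ.* q))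
  (ℚᵘ.≃-sym (ℚᵘ.≃-trans (ℚ.toℚᵘ-homo-* (ℚ.fromℚᵘ p) (ℚ.fromℚᵘ q))
    (ℚᵘ.*-cong (ℚ.toℚᵘ-fromℚᵘ p) (ℚ.toℚᵘ-fromℚᵘ q)))))

fromℚᵘ-homo-+ : ∀ p q → ℚ.fromℚᵘ (p ℚᵘ.+ q) ≡ ℚ.fromℚᵘ p ℚ.+ ℚ.fromℚᵘ q
fromℚᵘ-homo-+ p q = ℚ.toℚᵘ-injective (ℚᵘ.≃-trans (ℚ.toℚᵘ-fromℚᵘ (p ℚᵘ.+ q))
  (ℚᵘ.≃-sym (ℚᵘ.≃-trans (ℚ.toℚᵘ-homo-+ (ℚ.fromℚᵘ p) (ℚ.fromℚᵘ q))
    (ℚᵘ.+-cong (ℚ.toℚᵘ-fromℚᵘ p) (ℚ.toℚᵘ-fromℚᵘ q)))))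

-- Once the denominators are successors, both fractions are `fromℚᵘ` of unnormalised ones by
-- definition, so reduction to lowest terms is never unfolded.
/-*-/ : ∀ a b c d .{{_ : ℕ.NonZero b}} .{{_ : ℕ.NonZero d}} →
        (+ a ℚ./ b) ℚ.* (+ c ℚ./ d) ≡ (+ (a ℕ.* c) ℚ./ (b ℕ.* d)) {{ℕ.m*n≢0 b d}}
/-*-/ a b@(suc b-1) c d@(suc d-1) = ≡.trans
  (≡.sym (fromℚᵘ-homo-* (mkℚᵘ (+ a) b-1) (mkℚᵘ (+ c) d-1)))
  (≡.cong (λ i → i ℚ./ (b ℕ.* d)) (≡.sym (ℤ.pos-* a c)))

/-≡ : ∀ a b c d .{{_ : ℕ.NonZero b}} .{{_ : ℕ.NonZero d}} →
      a ℕ.* d ≡ c ℕ.* b → + a ℚ./ b ≡ + c ℚ./ d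
/-≡ a b@(suc b-1) c d@(suc d-1) eq = ℚ.fromℚᵘ-cong {mkℚᵘ (+ a) b-1} {mkℚᵘ (+ c) d-1}
  (*≡* (≡.trans (≡.sym (ℤ.pos-* a d)) (≡.trans (≡.cong +_ eq) (ℤ.pos-* c b))))

ℕ→ℚ : ℕ → ℚ
ℕ→ℚ n = + n ℚ./ 1

ℕ→ℚ-* : ∀ m n → ℕ→ℚ (m ℕ.* n) ≡ ℕ→ℚ m ℚ.* ℕ→ℚ n
ℕ→ℚ-* m n = ≡.sym (/-*-/ m 1 n 1)

ℕ→ℚ-+ : ∀ m n → ℕ→ℚ (m ℕ.+ n) ≡ ℕ→ℚ m ℚ.+ ℕ→ℚ n
ℕ→ℚ-+ m n = ≡.trans
  (≡.cong (ℚ._/ 1) (≡.sym (≡.cong₂ ℤ._+_ (ℤ.*-identityʳ (+ m)) (ℤ.*-identityʳ (+ n)))))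
  (fromℚᵘ-homo-+ (mkℚᵘ (+ m) 0) (mkℚᵘ (+ n) 0))

1/n*n≡1 : ∀ n .{{_ : ℕ.NonZero n}} → (+ 1 ℚ./ n) ℚ.* ℕ→ℚ n ≡ ℚ.1ℚ
1/n*n≡1 n = ≡.trans (/-*-/ 1 n n 1) (/-≡ (1 ℕ.* n) (n ℕ.* 1) 1 1 {{ℕ.m*n≢0 n 1}} (eq n))
  where
  eq : ∀ n → 1 ℕ.* n ℕ.* 1 ≡ 1 ℕ.* (n ℕ.* 1)
  eq = solve-∀

-- Isolates n!, which is common to all terms of the sum, and leaves one inverse factorial for each
-- of the three exponential generating series. The separate n with its equation suits sums in which
-- m is given as `n ∸ k ∸ l`.
trinomial≡n!/k!l!m! : ∀ k l m n → k ℕ.+ l ℕ.+ m ≡ n →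
                      trinomial k l m ≡ ℕ→ℚ (n !) ℚ.* (1/! k ℚ.* (1/! l ℚ.* 1/! m))
trinomial≡n!/k!l!m! k l m .(k ℕ.+ l ℕ.+ m) ≡.refl = ≡.sym (begin
  ℕ→ℚ (n !) ℚ.* (1/! k ℚ.* (1/! l ℚ.* 1/! m))
    ≡⟨ ≡.cong (λ q → ℕ→ℚ (n !) ℚ.* (1/! k ℚ.* q)) (/-*-/ 1 (l !) 1 (m !)) ⟩
  ℕ→ℚ (n !) ℚ.* (1/! k ℚ.* (+ 1 ℚ./ (l ! ℕ.* m !)))
    ≡⟨ ≡.cong (ℕ→ℚ (n !) ℚ.*_) (/-*-/ 1 (k !) 1 (l ! ℕ.* m !)) ⟩
  ℕ→ℚ (n !) ℚ.* (+ 1 ℚ./ (k ! ℕ.* (l ! ℕ.* m !)))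
    ≡⟨ /-*-/ (n !) 1 1 (k ! ℕ.* (l ! ℕ.* m !)) ⟩
  + (n ! ℕ.* 1) ℚ./ (1 ℕ.* (k ! ℕ.* (l ! ℕ.* m !)))
    ≡⟨ /-≡ (n ! ℕ.* 1) (1 ℕ.* (k ! ℕ.* (l ! ℕ.* m !))) (n !) (k ! ℕ.* l ! ℕ.* m !)
         (eq (n !) (k !) (l !) (m !)) ⟩
  trinomial k l m ∎)
  where
  open ≡.≡-Reasoning
  n = k ℕ.+ l ℕ.+ m
  instance
    k!≢0 = k ℕ.!≢0
    l!≢0 = l ℕ.!≢0
    m!≢0 = m ℕ.!≢0
    lm≢0 = ℕ.m*n≢0 (l !) (m !)
    klm≢0 = ℕ.m*n≢0 (k !) (l ! ℕ.* m !)
    1klm≢0 = ℕ.m*n≢0 1 (k ! ℕ.* (l ! ℕ.* m !))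
    kl≢0 = ℕ.m*n≢0 (k !) (l !)
    klm′≢0 = ℕ.m*n≢0 (k ! ℕ.* l !) (m !)
  eq : ∀ n k l m → n ℕ.* 1 ℕ.* (k ℕ.* l ℕ.* m) ≡ n ℕ.* (1 ℕ.* (k ℕ.* (l ℕ.* m)))
  eq = solve-∀

-- Cancelling the denominators, and sums over k + l + m = n as coefficients

module Products (R : CommutativeRing c ℓ) where
  open CommutativeRing R
  open RingLemmas R using (Cancellable)
  open RingProperties ring using (x[y-z]≈xy-xz)
  open GroupProperties +-group using (x∙y⁻¹≈ε⇒x≈y; x≈y⇒x∙y⁻¹≈ε)
  open CommutativeMonoidSolver *-commutativeMonoid
  open ≈-Reasoning setoid

  cancelˡ : ∀ {x} → Cancellable x → ∀ y z → x * y ≈ x * z → y ≈ z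
  cancelˡ {x} x-canc y z eq = x∙y⁻¹≈ε⇒x≈y y z
    (x-canc (y - z) (trans (x[y-z]≈xy-xz x y z) (x≈y⇒x∙y⁻¹≈ε eq)))

  -- G i j stands for the series t e^(xt) S / D of wᵢ evaluated at (wⱼ y, wᵢ t).
  cyclic-symmetry : {I : Set} (D T S : I → Carrier) (E G : I → I → Carrier) →
    (∀ i → Cancellable (D i)) → (∀ i j → E i j ≈ E j i) →
    (∀ i j → D i * G i j ≈ (T i * E i j) * S i) →
    ∀ i j k → G k i * (G i j * G j k) ≈ G j i * (G i k * G k j)
  cyclic-symmetry D T S E G D-canc E-sym eq i j k =
    cancelˡ (D-canc k) _ _ (cancelˡ (D-canc i) _ _ (cancelˡ (D-canc j) _ _ (begin
      D j * (D i * (D k * (G k i * (G i j * G j k))))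
        ≈⟨ solve 6 (λ a b c x y z → (a ⊕ (b ⊕ (c ⊕ (x ⊕ (y ⊕ z))))) ⊜
             ((c ⊕ x) ⊕ ((b ⊕ y) ⊕ (a ⊕ z)))) refl (D j) (D i) (D k) (G k i) (G i j) (G j k) ⟩
      D k * G k i * (D i * G i j * (D j * G j k))
        ≈⟨ *-cong (eq k i) (*-cong (eq i j) (eq j k)) ⟩
      T k * E k i * S k * (T i * E i j * S i * (T j * E j k * S j))
        -- Reversing the cycle swaps the two indices of each `E`. The factors `T` and `S` see the
        -- first index only, and in both products each of i, j, k is a first index exactly once.
        ≈⟨ *-cong (*-congʳ (*-congˡ (E-sym k i)))
             (*-cong (*-congʳ (*-congˡ (E-sym i j))) (*-congʳ (*-congˡ (E-sym j k)))) ⟩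
      T k * E i k * S k * (T i * E j i * S i * (T j * E k j * S j))
        ≈⟨ solve 9 (λ t₁ t₂ t₃ e₁ e₂ e₃ s₁ s₂ s₃ →
             (((t₁ ⊕ e₁) ⊕ s₁) ⊕ (((t₂ ⊕ e₂) ⊕ s₂) ⊕ ((t₃ ⊕ e₃) ⊕ s₃))) ⊜
             (((t₃ ⊕ e₂) ⊕ s₃) ⊕ (((t₂ ⊕ e₁) ⊕ s₂) ⊕ ((t₁ ⊕ e₃) ⊕ s₁)))) refl
             (T k) (T i) (T j) (E i k) (E j i) (E k j) (S k) (S i) (S j) ⟩
      T j * E j i * S j * (T i * E i k * S i * (T k * E k j * S k))
        ≈⟨ *-cong (eq j i) (*-cong (eq i k) (eq k j)) ⟨
      D j * G j i * (D i * G i k * (D k * G k j))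
        ≈⟨ solve 6 (λ a b c x y z → (a ⊕ (b ⊕ (c ⊕ (x ⊕ (y ⊕ z))))) ⊜
             ((a ⊕ x) ⊕ ((b ⊕ y) ⊕ (c ⊕ z)))) refl (D j) (D i) (D k) (G j i) (G i k) (G k j) ⟨
      D j * (D i * (D k * (G j i * (G i k * G k j)))) ∎)))

  -- Here and in `trinomial-term`, `N` stands for n!, the `b` for Bernoulli polynomials at their
  -- arguments, the `i` for inverse factorials and the `s` for powers of the weights. Each group b i
  -- s is a coefficient of one generating series.
  trinomial-monomial : ∀ N b₁ b₂ b₃ i₁ i₂ i₃ s₁ s₂ s₃ →
    N * (i₁ * (i₂ * i₃)) * b₁ * b₂ * b₃ * (s₁ * s₂ * s₃) ≈
    N * (b₁ * i₁ * s₁ * (b₂ * i₂ * s₂ * (b₃ * i₃ * s₃)))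
  trinomial-monomial = solve 10 (λ N b₁ b₂ b₃ i₁ i₂ i₃ s₁ s₂ s₃ →
    (((((N ⊕ (i₁ ⊕ (i₂ ⊕ i₃))) ⊕ b₁) ⊕ b₂) ⊕ b₃) ⊕ ((s₁ ⊕ s₂) ⊕ s₃)) ⊜
    (N ⊕ (((b₁ ⊕ i₁) ⊕ s₁) ⊕ (((b₂ ⊕ i₂) ⊕ s₂) ⊕ ((b₃ ⊕ i₃) ⊕ s₃))))) refl

  trinomial-term : ∀ a N W b₁ b₂ b₃ i₁ i₂ i₃ s₁ s₂ s₃ g₁ g₂ g₃ →
    a ≈ N * (i₁ * (i₂ * i₃)) → W ≈ s₁ * s₂ * s₃ →
    g₁ ≈ b₁ * i₁ * s₁ → g₂ ≈ b₂ * i₂ * s₂ → g₃ ≈ b₃ * i₃ * s₃ →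
    a * b₁ * b₂ * b₃ * W ≈ N * (g₁ * (g₂ * g₃))
  trinomial-term a N W b₁ b₂ b₃ i₁ i₂ i₃ s₁ s₂ s₃ g₁ g₂ g₃ a≈ W≈ g₁≈ g₂≈ g₃≈ = begin
    a * b₁ * b₂ * b₃ * W
      ≈⟨ *-cong (*-congʳ (*-congʳ (*-congʳ a≈))) W≈ ⟩
    N * (i₁ * (i₂ * i₃)) * b₁ * b₂ * b₃ * (s₁ * s₂ * s₃)
      ≈⟨ trinomial-monomial N b₁ b₂ b₃ i₁ i₂ i₃ s₁ s₂ s₃ ⟩
    N * (b₁ * i₁ * s₁ * (b₂ * i₂ * s₂ * (b₃ * i₃ * s₃)))
      ≈⟨ *-congˡ (*-cong g₁≈ (*-cong g₂≈ g₃≈)) ⟨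
    N * (g₁ * (g₂ * g₃)) ∎

  open Exp commutativeSemiring using (_^_; ^-assocʳ; ^-congˡ)

  ^-rootOfUnity : ∀ x m n → x ^ n ≈ 1# → (x ^ m) ^ n ≈ 1#
  ^-rootOfUnity x m n xⁿ≈1 = begin
    (x ^ m) ^ n    ≈⟨ ^-assocʳ x m n ⟩
    x ^ (m ℕ.* n)  ≡⟨ ≡.cong (x ^_) (ℕ.*-comm m n) ⟩
    x ^ (n ℕ.* m)  ≈⟨ ^-assocʳ x n m ⟨
    (x ^ n) ^ m    ≈⟨ ^-congˡ m xⁿ≈1 ⟩
    1# ^ m         ≈⟨ 1^n≈1 m ⟩
    1#             ∎
    where
    1^n≈1 : ∀ n → 1# ^ n ≈ 1#
    1^n≈1 zero    = refl
    1^n≈1 (suc n) = trans (*-identityˡ _) (1^n≈1 n)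

module TripleProduct (R : CommutativeRing c ℓ) where
  open CommutativeRing R
  open PowerSeries rawRing using (Series; _*ˢ_)
  open Sum semiring using (sum; sum-cong-≋; *-distribˡ-sum; sum⁺-syntax)
  open ≈-Reasoning setoid

  -- The nested sum is `f *ˢ (g *ˢ h)` written out, with the constant moved inside. The hypothesis
  -- is restricted to k + l + m = n because only there does the trinomial coefficient have numerator
  -- n!.
  *ˢ-triple : ∀ n N (f g h : Series) (s : ℕ → ℕ → ℕ → Carrier) →
    (∀ k l m → k ℕ.+ l ℕ.+ m ≡ n → s k l m ≈ N * (f k * (g l * h m))) →
    sum {suc n} (λ i → let k = toℕ i in
    sum {suc (n ∸ k)} (λ j → let l = toℕ j in s k l (n ∸ k ∸ l))) ≈ N * (f *ˢ (g *ˢ h)) n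
  *ˢ-triple n N f g h s eq = begin
    (∑[ i ≤ n ] ∑[ j ≤ n ∸ toℕ i ] s (toℕ i) (toℕ j) (n ∸ toℕ i ∸ toℕ j))
      ≈⟨ sum-cong-≋ {suc n} (λ i → sum-cong-≋ {suc (n ∸ toℕ i)} (λ j → eq (toℕ i) (toℕ j) (n ∸ toℕ i ∸ toℕ j)
           (index-sum (toℕ i) (toℕ j) (toℕ≤n i) (toℕ≤n j)))) ⟩
    (∑[ i ≤ n ] ∑[ j ≤ n ∸ toℕ i ] (N * (f (toℕ i) * gh (n ∸ toℕ i) j)))
      ≈⟨ sum-cong-≋ {suc n} (λ i → trans
           (*-congˡ (*-distribˡ-sum (f (toℕ i)) (gh (n ∸ toℕ i))))
           (*-distribˡ-sum N (λ j → f (toℕ i) * gh (n ∸ toℕ i) j))) ⟨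
    (∑[ i ≤ n ] (N * (f (toℕ i) * (g *ˢ h) (n ∸ toℕ i))))
      ≈⟨ *-distribˡ-sum {suc n} N (λ i → f (toℕ i) * (g *ˢ h) (n ∸ toℕ i)) ⟨
    N * (f *ˢ (g *ˢ h)) n ∎
    where
    gh : ∀ n → Fin (suc n) → Carrier
    gh n j = g (toℕ j) * h (n ∸ toℕ j)
    toℕ≤n : ∀ {n} (i : Fin (suc n)) → toℕ i ≤ n
    toℕ≤n i = ℕ.≤-pred (Fin.toℕ<n i)
    -- The bounds on k and l make both truncated subtractions exact.
    index-sum : ∀ k l → k ≤ n → l ≤ n ∸ k → k ℕ.+ l ℕ.+ (n ∸ k ∸ l) ≡ n
    index-sum k l k≤n l≤n-k = ≡.trans (ℕ.+-assoc k l _)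
      (≡.trans (≡.cong (k ℕ.+_) (ℕ.m+[n∸m]≡n l≤n-k)) (ℕ.m+[n∸m]≡n k≤n))

-- Transport of the defining equation to (w y, u t)

-- R plays the role of K[x], and κ that of the embedding of K.
module Substitution (R : CommutativeRing c ℓ) {A : Set c′} (κ : A → CommutativeRing.Carrier R)
                    (x : CommutativeRing.Carrier R) (inv! : ℕ → A) where
  open CommutativeRing R
  open SeriesProperties R using (module 𝕊; const-cong; rootOfUnity-cancellable)
    renaming (commutativeRing to R⟦t⟧)
  open PowerSeries rawRing using (Series; const; t; expWith)
  open Exp commutativeSemiring using (_^_; ^-congˡ; ^-distrib-*)
  open Mult +-commutativeMonoid using (_×_; ×-congʳ)
  open Sum 𝕊.semiring using (sum; sum-cong-≋)
  open SeriesHomomorphism R R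
  open CommutativeSemigroup *-commutativeSemigroup using (xy∙z≈zy∙x)
  open RingMorphisms rawRing rawRing using (IsRingHomomorphism)

  exp : Carrier → Series
  exp = expWith (κ ∘ inv!)

  -- This and the next two series are e^(b u t), u t and e^(w x u t), with the power of u kept as
  -- the last factor, as `substitute` produces it.
  exp-at : A → A → Series
  exp-at u b n = κ (inv! n) * κ b ^ n * κ u ^ n

  t-at : A → Series
  t-at u n = t n * κ u ^ n

  expx-at : A → A → Series
  expx-at u w n = κ (inv! n) * (κ w * x) ^ n * κ u ^ n

  expx-at-sym : ∀ u w → expx-at u w 𝕊.≈ expx-at w u
  expx-at-sym u w n = begin
    κ (inv! n) * (κ w * x) ^ n * κ u ^ n    ≈⟨ *-assoc _ _ _ ⟩
    κ (inv! n) * ((κ w * x) ^ n * κ u ^ n)  ≈⟨ *-congˡ (^-distrib-* (κ w * x) (κ u) n) ⟨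
    κ (inv! n) * (κ w * x * κ u) ^ n        ≈⟨ *-congˡ (^-congˡ n (xy∙z≈zy∙x _ _ _)) ⟩
    κ (inv! n) * (κ u * x * κ w) ^ n        ≈⟨ *-congˡ (^-distrib-* (κ u * x) (κ w) n) ⟩
    κ (inv! n) * ((κ u * x) ^ n * κ w ^ n)  ≈⟨ *-assoc _ _ _ ⟨
    κ (inv! n) * (κ u * x) ^ n * κ w ^ n    ∎
    where open ≈-Reasoning setoid

  -- This is z e^(b u t) - 1. It has no argument w: its coefficients are constants, which the
  -- substitution of w x for x fixes. Hence both products in the theorem have the same three
  -- denominators.
  denominator-at : A → A → A → Series
  denominator-at u z b = const (κ z) 𝕊.* exp-at u b 𝕊.+ 𝕊.- 𝕊.1#

  numerator-at : ∀ {d} → A → (Fin d → A) → (Fin d → A) → Series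
  numerator-at u α β = sum λ i → const (κ (α i)) 𝕊.* exp-at u (β i)

  -- The element `v` inverts r b u, the coefficient of t in e^(r b u t).
  denominator-cancellable : ∀ u z b v r → κ (inv! 0) ≈ 1# → κ z ^ r ≈ 1# →
    v * (r × (κ (inv! 1) * κ b * κ u)) ≈ 1# →
    RingLemmas.Cancellable R⟦t⟧ (denominator-at u z b)
  denominator-cancellable u z b v r inv!0≈1 zʳ≈1 eq =
    rootOfUnity-cancellable (exp-at u b) (κ z) v r
      (trans (*-identityʳ _) (trans (*-identityʳ _) inv!0≈1)) zʳ≈1
      (trans (*-congˡ (×-congʳ r (*-cong (*-congˡ (*-identityʳ _)) (*-identityʳ _)))) eq)

  module _ (φ : Carrier → Carrier) (φ-homo : IsRingHomomorphism φ)
           (φ-κ : ∀ a → φ (κ a) ≈ κ a) (u w : A) (φ-x : φ x ≈ κ w * x) where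
    private
      module φ = IsRingHomomorphism φ-homo
      Φ = substitute φ (κ u)
      Φ-homo = substitute-isRingHomomorphism φ-homo (κ u)
      module Φ = RingMorphisms.IsRingHomomorphism Φ-homo
    open HomomorphismProperties rawRing R using (^-homo)
    open HomomorphismProperties 𝕊.rawRing R⟦t⟧ using (sum-homo)

    private
      φ-κ^ : ∀ a n → φ (κ a ^ n) ≈ κ a ^ n
      φ-κ^ a n = trans (^-homo φ-homo (κ a) n) (^-congˡ n (φ-κ a))

    substitute-exp : ∀ b → Φ (exp (κ b)) 𝕊.≈ exp-at u b
    substitute-exp b n = *-congʳ (trans (φ.*-homo _ _) (*-cong (φ-κ _) (φ-κ^ b n)))

    substitute-expx : Φ (exp x) 𝕊.≈ expx-at u w
    substitute-expx n = *-congʳ (trans (φ.*-homo _ _)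
      (*-cong (φ-κ _) (trans (^-homo φ-homo x n) (^-congˡ n φ-x))))

    substitute-t : Φ t 𝕊.≈ t-at u
    substitute-t 0             = *-congʳ φ.0#-homo
    substitute-t 1             = *-congʳ φ.1#-homo
    substitute-t (suc (suc n)) = *-congʳ φ.0#-homo

    substitute-scaled-exp : ∀ z b → Φ (const (κ z) 𝕊.* exp (κ b)) 𝕊.≈ const (κ z) 𝕊.* exp-at u b
    substitute-scaled-exp z b = 𝕊.trans (Φ.*-homo (const (κ z)) (exp (κ b)))
      (𝕊.*-cong {Φ (const (κ z))} {const (κ z)} {Φ (exp (κ b))} {exp-at u b}
        (λ n → trans (substitute-const φ-homo (κ u) (κ z) n) (const-cong (φ-κ z) n))
        (substitute-exp b))

    -- A ring homomorphism of K[x]⟦t⟧ carries the equation over factor by factor. The scaling w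
    -- enters through the image of `exp x` alone; all other factors on the right depend only on u.
    substitute-equation : ∀ z b {d} (α β : Fin d → A) f →
      (const (κ z) 𝕊.* exp (κ b) 𝕊.+ 𝕊.- 𝕊.1#) 𝕊.* f 𝕊.≈
        t 𝕊.* exp x 𝕊.* sum (λ i → const (κ (α i)) 𝕊.* exp (κ (β i))) →
      denominator-at u z b 𝕊.* Φ f 𝕊.≈ t-at u 𝕊.* expx-at u w 𝕊.* numerator-at u α β
    substitute-equation z b {d} α β f eq = begin
      denominator-at u z b 𝕊.* Φ f
        ≈⟨ 𝕊.*-cong {Φ D} {denominator-at u z b} {Φ f} {Φ f} Φ-denominator 𝕊.refl ⟨
      Φ D 𝕊.* Φ f                       ≈⟨ Φ.*-homo D f ⟨
      Φ (D 𝕊.* f)                       ≈⟨ Φ.⟦⟧-cong eq ⟩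
      Φ (t 𝕊.* exp x 𝕊.* N)             ≈⟨ Φ.*-homo (t 𝕊.* exp x) N ⟩
      Φ (t 𝕊.* exp x) 𝕊.* Φ N
        ≈⟨ 𝕊.*-cong {Φ (t 𝕊.* exp x)} {Φ t 𝕊.* Φ (exp x)} {Φ N} {numerator-at u α β}
              (Φ.*-homo t (exp x)) Φ-numerator ⟩
      Φ t 𝕊.* Φ (exp x) 𝕊.* numerator-at u α β
        ≈⟨ 𝕊.*-cong {Φ t 𝕊.* Φ (exp x)} {t-at u 𝕊.* expx-at u w}
                     {numerator-at u α β} {numerator-at u α β}
              (𝕊.*-cong {Φ t} {t-at u} {Φ (exp x)} {expx-at u w} substitute-t substitute-expx)
              𝕊.refl ⟩
      t-at u 𝕊.* expx-at u w 𝕊.* numerator-at u α β ∎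
      where
      open ≈-Reasoning 𝕊.setoid
      D N : Series
      D = const (κ z) 𝕊.* exp (κ b) 𝕊.+ 𝕊.- 𝕊.1#
      N = sum (λ i → const (κ (α i)) 𝕊.* exp (κ (β i)))
      Φ-denominator : Φ D 𝕊.≈ denominator-at u z b
      Φ-denominator = 𝕊.trans (Φ.+-homo (const (κ z) 𝕊.* exp (κ b)) (𝕊.- 𝕊.1#))
        (𝕊.+-cong (substitute-scaled-exp z b)
          (𝕊.trans (Φ.-‿homo 𝕊.1#) (𝕊.-‿cong Φ.1#-homo)))
      Φ-numerator : Φ N 𝕊.≈ numerator-at u α β
      Φ-numerator = 𝕊.trans (sum-homo Φ-homo (λ i → const (κ (α i)) 𝕊.* exp (κ (β i))))
        (sum-cong-≋ (λ i → substitute-scaled-exp (α i) (β i)))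

-- Rational identities to be carried into K[x]

ℚ-ring : RawRing _ _
ℚ-ring = fieldRing ℚ-field

private module ℚ′ = RawSemiringDefinitions (RawRing.rawSemiring ℚ-ring)

ℕ→ℚ-^ : ∀ m n → ℕ→ℚ (m ℕ.^ n) ≡ ℕ→ℚ m ℚ′.^ n
ℕ→ℚ-^ m zero    = ≡.refl
ℕ→ℚ-^ m (suc n) = ≡.trans (ℕ→ℚ-* m (m ℕ.^ n)) (≡.cong (ℕ→ℚ m ℚ.*_) (ℕ→ℚ-^ m n))

ℕ→ℚ-× : ∀ m n → ℕ→ℚ (m ℕ.* n) ≡ m ℚ′.× ℕ→ℚ n
ℕ→ℚ-× zero    n = ≡.refl
ℕ→ℚ-× (suc m) n = ≡.trans (ℕ→ℚ-+ n (m ℕ.* n)) (≡.cong (ℕ→ℚ n ℚ.+_) (ℕ→ℚ-× m n))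

ℕ→ℚ-monomial : ∀ a b c k l m →
  ℕ→ℚ (a ℕ.^ k ℕ.* b ℕ.^ l ℕ.* c ℕ.^ m) ≡ ℕ→ℚ a ℚ′.^ k ℚ.* ℕ→ℚ b ℚ′.^ l ℚ.* ℕ→ℚ c ℚ′.^ m
ℕ→ℚ-monomial a b c k l m = ≡.trans (ℕ→ℚ-* (a ℕ.^ k ℕ.* b ℕ.^ l) (c ℕ.^ m))
  (≡.cong₂ ℚ._*_ (≡.trans (ℕ→ℚ-* (a ℕ.^ k) (b ℕ.^ l))
    (≡.cong₂ ℚ._*_ (ℕ→ℚ-^ a k) (ℕ→ℚ-^ b l))) (ℕ→ℚ-^ c m))

-- Characteristic zero enters here: the positive integer r d w is a unit of ℚ, and any ring
-- homomorphism out of ℚ preserves its inverse. The factor `1/! 1`, which computes to 1, is the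
-- coefficient of t in e^t.
slope-invertible : ∀ r d w .{{_ : NonZero (r ℕ.* (d ℕ.* w))}} →
  (+ 1 ℚ./ (r ℕ.* (d ℕ.* w))) ℚ.* (r ℚ′.× (1/! 1 ℚ.* ℕ→ℚ d ℚ.* ℕ→ℚ w)) ≡ ℚ.1ℚ
slope-invertible r d w = ≡.trans (≡.cong (1/rdw ℚ.*_) (begin
  r ℚ′.× (ℚ.1ℚ ℚ.* ℕ→ℚ d ℚ.* ℕ→ℚ w)
    ≡⟨ ≡.cong (λ q → r ℚ′.× (q ℚ.* ℕ→ℚ w)) (ℚ.*-identityˡ (ℕ→ℚ d)) ⟩
  r ℚ′.× (ℕ→ℚ d ℚ.* ℕ→ℚ w)           ≡⟨ ≡.cong (r ℚ′.×_) (ℕ→ℚ-* d w) ⟨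
  r ℚ′.× ℕ→ℚ (d ℕ.* w)               ≡⟨ ℕ→ℚ-× r (d ℕ.* w) ⟨
  ℕ→ℚ (r ℕ.* (d ℕ.* w))              ∎)) (1/n*n≡1 (r ℕ.* (d ℕ.* w)))
  where
  open ≡.≡-Reasoning
  1/rdw = + 1 ℚ./ (r ℕ.* (d ℕ.* w))

-- Generating series of the twisted Bernoulli polynomials

module TwistedBernoulli {p : ℕ} (T : ℂₚ-Tower p c ℓ₁ ℓ₂) where
  open Bernoulli T
  open ℂₚ-Tower T using (module ℚₚ; module ℚ̄ₚ; module ℂₚ)

  K-commutativeRing : CommutativeRing c ℓ₁
  K-commutativeRing =
    HeytingCommutativeRing.commutativeRing (HeytingField.heytingCommutativeRing ℂₚ-field)

  open PolynomialProperties K-commutativeRing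
    using (const-isRingHomomorphism; module Evaluation)
  open PolynomialProperties K-commutativeRing public
    using () renaming (commutativeRing to K[x]-commutativeRing)

  private
    module KR = CommutativeRing K-commutativeRing
    module KxR = CommutativeRing K[x]-commutativeRing

  -- Not the parameter `κ` of `Substitution`, which is instantiated with `K[x].const`: the source
  -- here is ℚ, where the numerical identities are proved.
  κ : ℚ → Poly
  κ = K[x].const ∘ fromℚ

  fromℚ-isRingHomomorphism : RingMorphisms.IsRingHomomorphism ℚ-ring K fromℚ
  fromℚ-isRingHomomorphism = Composition.isRingHomomorphism KR.trans
    (Composition.isRingHomomorphism (HeytingField.trans ℚ̄ₚ.closure) ℚₚ.ι-homo ℚ̄ₚ.ι-homo)
    ℂₚ.ι-homo

  κ-isRingHomomorphism : RingMorphisms.IsRingHomomorphism ℚ-ring K[x] κ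
  κ-isRingHomomorphism = Composition.isRingHomomorphism
    (λ {f} {g} {h} → KxR.trans {f} {g} {h}) fromℚ-isRingHomomorphism const-isRingHomomorphism

  private
    module κ = RingMorphisms.IsRingHomomorphism κ-isRingHomomorphism
    module κ-Properties = HomomorphismProperties ℚ-ring K[x]-commutativeRing
    -- Evaluation with values in K[x] itself makes `_at w ·y` a ring endomorphism of K[x] that fixes
    -- constants and sends x to w x.
    module At (w : ℕ) = Evaluation K[x]-commutativeRing const-isRingHomomorphism
                          (K[x].const (fromℕ w) K[x].* x)

  open Substitution K[x]-commutativeRing K[x].const x (fromℚ ∘ 1/!)
    using (denominator-at; t-at; expx-at; expx-at-sym; numerator-at; denominator-cancellable;
           substitute-equation)
  open SeriesHomomorphism K[x]-commutativeRing K[x]-commutativeRing using (substitute)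
  open RingLemmas (SeriesProperties.commutativeRing K[x]-commutativeRing) using (Cancellable)
  open Products using (cyclic-symmetry; trinomial-term; ^-rootOfUnity)
  open Exp KxR.commutativeSemiring using (_^_)
  open TripleProduct K[x]-commutativeRing using (*ˢ-triple)

  generating-at : (B : ℕ → Poly) (u w : ℕ) → K[x]⟦t⟧.Series
  generating-at B u w = substitute (_at w ·y) (K[x].const (fromℕ u)) (λ n → B n K[x].* inv! n)

  generating-at-coeff : ∀ B u w n →
    generating-at B u w n K[x].≈ ((B n at w ·y) K[x].* inv! n K[x].* κ (ℕ→ℚ u) ^ n)
  generating-at-coeff B u w n = KxR.*-congʳ {κ (ℕ→ℚ u) ^ n}
    {(B n K[x].* inv! n) at w ·y} {(B n at w ·y) K[x].* inv! n} (begin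
      (B n K[x].* inv! n) at w ·y             ≈⟨ At.eval-* w (B n) (inv! n) ⟩
      (B n at w ·y) K[x].* (inv! n at w ·y)   ≈⟨ KxR.*-congˡ {B n at w ·y} {inv! n at w ·y} {inv! n}
                                                   (At.eval-const w (fromℚ (1/! n))) ⟩
      (B n at w ·y) K[x].* inv! n             ∎)
    where open ≈-Reasoning KxR.setoid

  twisted-denominator-cancellable : ∀ d {{_ : NonZero d}} r {{_ : NonZero r}} w {{_ : NonZero w}} z →
    z K.^ r K.≈ K.1# → Cancellable (denominator-at (fromℕ w) z (fromℕ d))
  twisted-denominator-cancellable d r w z zʳ≈1 =
    denominator-cancellable (fromℕ w) z (fromℕ d) (κ 1/rdw) r κ.1#-homo constzʳ≈1 (begin
      κ 1/rdw K[x].* (r × (inv! 1 K[x].* κ (ℕ→ℚ d) K[x].* κ (ℕ→ℚ w)))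
        ≈⟨ κ-Properties.*×-homo κ-isRingHomomorphism 1/rdw r (1/! 1) (ℕ→ℚ d) (ℕ→ℚ w) ⟨
      κ (1/rdw ℚ.* (r ℚ′.× (1/! 1 ℚ.* ℕ→ℚ d ℚ.* ℕ→ℚ w)))
        ≈⟨ κ.⟦⟧-cong (slope-invertible r d w) ⟩
      κ ℚ.1ℚ
        ≈⟨ κ.1#-homo ⟩
      K[x].1# ∎)
    where
    open ≈-Reasoning KxR.setoid
    open Mult KxR.+-commutativeMonoid using (_×_)
    instance
      dw≢0 : NonZero (d ℕ.* w)
      dw≢0 = ℕ.m*n≢0 d w
      rdw≢0 : NonZero (r ℕ.* (d ℕ.* w))
      rdw≢0 = ℕ.m*n≢0 r (d ℕ.* w)
    1/rdw : ℚ
    1/rdw = + 1 ℚ./ (r ℕ.* (d ℕ.* w))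
    constzʳ≈1 : K[x].const z ^ r K[x].≈ K[x].1#
    constzʳ≈1 = begin
      K[x].const z ^ r
        ≈⟨ HomomorphismProperties.^-homo K K[x]-commutativeRing const-isRingHomomorphism z r ⟨
      K[x].const (z K.^ r)  ≈⟨ const.⟦⟧-cong zʳ≈1 ⟩
      K[x].1#               ∎
      where module const = RingMorphisms.IsRingHomomorphism const-isRingHomomorphism

  twisted-equation : ∀ d χ η B → IsTwistedBernoulli d χ η B → ∀ u w →
    denominator-at (fromℕ u) (η K.^ d) (fromℕ d) K[x]⟦t⟧.* generating-at B u w K[x]⟦t⟧.≈
      t-at (fromℕ u) K[x]⟦t⟧.* expx-at (fromℕ u) (fromℕ w) K[x]⟦t⟧.*
      numerator-at {d} (fromℕ u) (λ i → χ (+ toℕ i) K.* η K.^ toℕ i) (fromℕ ∘ toℕ)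
  twisted-equation d χ η B eq u w = substitute-equation (_at w ·y) (At.eval-isRingHomomorphism w)
    (At.eval-const w) (fromℕ u) (fromℕ w) (At.eval-var w) (η K.^ d) (fromℕ d) {d}
    (λ i → χ (+ toℕ i) K.* η K.^ toℕ i) (fromℕ ∘ toℕ) (λ n → B n K[x].* inv! n) eq

  -- The `u` are the weights that are raised to powers, the `w` those that scale the arguments. Both
  -- sides of the theorem unfold to instances of this sum.
  trinomialSum : ℕ → (A B C : ℕ → Poly) (u₁ u₂ u₃ w₁ w₂ w₃ : ℕ) → Poly
  trinomialSum n A B C u₁ u₂ u₃ w₁ w₂ w₃ = ∑₃ n λ k l m →
    K[x].const (fromℚ (trinomial k l m))
      K[x].* (A k at w₁ ·y) K[x].* (B l at w₂ ·y) K[x].* (C m at w₃ ·y)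
      K[x].* K[x].const (fromℕ (u₁ ℕ.^ k ℕ.* u₂ ℕ.^ l ℕ.* u₃ ℕ.^ m))

  -- Multiplication of exponential generating functions: n! times the n-th coefficient of a product
  -- of three is the trinomial convolution of their sequences.
  trinomial-convolution : ∀ n (A B C : ℕ → Poly) u₁ u₂ u₃ w₁ w₂ w₃ →
    trinomialSum n A B C u₁ u₂ u₃ w₁ w₂ w₃ K[x].≈
    (κ (ℕ→ℚ (n !)) K[x].*
      (generating-at A u₁ w₁ K[x]⟦t⟧.* (generating-at B u₂ w₂ K[x]⟦t⟧.* generating-at C u₃ w₃)) n)
  trinomial-convolution n A B C u₁ u₂ u₃ w₁ w₂ w₃ =
    *ˢ-triple n (κ (ℕ→ℚ (n !))) (generating-at A u₁ w₁) (generating-at B u₂ w₂) (generating-at C u₃ w₃)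
      (λ k l m → K[x].const (fromℚ (trinomial k l m))
        K[x].* (A k at w₁ ·y) K[x].* (B l at w₂ ·y) K[x].* (C m at w₃ ·y)
        K[x].* K[x].const (fromℕ (u₁ ℕ.^ k ℕ.* u₂ ℕ.^ l ℕ.* u₃ ℕ.^ m)))
      λ k l m k+l+m≡n → trinomial-term K[x]-commutativeRing
        (κ (trinomial k l m)) (κ (ℕ→ℚ (n !))) (κ (ℕ→ℚ (u₁ ℕ.^ k ℕ.* u₂ ℕ.^ l ℕ.* u₃ ℕ.^ m)))
        (A k at w₁ ·y) (B l at w₂ ·y) (C m at w₃ ·y) (inv! k) (inv! l) (inv! m)
        (κ (ℕ→ℚ u₁) ^ k) (κ (ℕ→ℚ u₂) ^ l) (κ (ℕ→ℚ u₃) ^ m)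
        (generating-at A u₁ w₁ k) (generating-at B u₂ w₂ l) (generating-at C u₃ w₃ m)
        (begin
          κ (trinomial k l m)
            ≈⟨ κ.⟦⟧-cong (trinomial≡n!/k!l!m! k l m n k+l+m≡n) ⟩
          κ (ℕ→ℚ (n !) ℚ.* (1/! k ℚ.* (1/! l ℚ.* 1/! m)))
            ≈⟨ κ-Properties.*-homo₄ κ-isRingHomomorphism (ℕ→ℚ (n !)) (1/! k) (1/! l) (1/! m) ⟩
          κ (ℕ→ℚ (n !)) K[x].* (inv! k K[x].* (inv! l K[x].* inv! m)) ∎)
        (begin
          κ (ℕ→ℚ (u₁ ℕ.^ k ℕ.* u₂ ℕ.^ l ℕ.* u₃ ℕ.^ m))
            ≈⟨ κ.⟦⟧-cong (ℕ→ℚ-monomial u₁ u₂ u₃ k l m) ⟩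
          κ (ℕ→ℚ u₁ ℚ′.^ k ℚ.* ℕ→ℚ u₂ ℚ′.^ l ℚ.* ℕ→ℚ u₃ ℚ′.^ m)
            ≈⟨ κ-Properties.monomial-homo κ-isRingHomomorphism (ℕ→ℚ u₁) (ℕ→ℚ u₂) (ℕ→ℚ u₃) k l m ⟩
          κ (ℕ→ℚ u₁) ^ k K[x].* κ (ℕ→ℚ u₂) ^ l K[x].* κ (ℕ→ℚ u₃) ^ m ∎)
        (generating-at-coeff A u₁ w₁ k) (generating-at-coeff B u₂ w₂ l) (generating-at-coeff C u₃ w₃ m)
    where open ≈-Reasoning KxR.setoid

  generating-symmetry : ∀ d {{_ : NonZero d}} χ r {{_ : NonZero r}} ξ → ξ K.^ r K.≈ K.1# →
    (w : Fin 3 → ℕ) → (∀ i → NonZero (w i)) → (B : Fin 3 → ℕ → Poly) →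
    (∀ i → IsTwistedBernoulli d χ (ξ K.^ w i) (B i)) →
    let G = λ i j → generating-at (B i) (w i) (w j) in ∀ i j k →
    G k i K[x]⟦t⟧.* (G i j K[x]⟦t⟧.* G j k) K[x]⟦t⟧.≈ G j i K[x]⟦t⟧.* (G i k K[x]⟦t⟧.* G k j)
  generating-symmetry d χ r ξ ξʳ≈1 w w≢0 B eq =
    cyclic-symmetry (SeriesProperties.commutativeRing K[x]-commutativeRing)
      (λ i → denominator-at (fromℕ (w i)) ((ξ K.^ w i) K.^ d) (fromℕ d))
      (λ i → t-at (fromℕ (w i)))
      (λ i → numerator-at {d} (fromℕ (w i)) (λ a → χ (+ toℕ a) K.* (ξ K.^ w i) K.^ toℕ a) (fromℕ ∘ toℕ))
      (λ i j → expx-at (fromℕ (w i)) (fromℕ (w j)))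
      (λ i j → generating-at (B i) (w i) (w j))
      (λ i → twisted-denominator-cancellable d r (w i) {{w≢0 i}} ((ξ K.^ w i) K.^ d)
        (^-rootOfUnity K-commutativeRing (ξ K.^ w i) d r
          (^-rootOfUnity K-commutativeRing ξ (w i) r ξʳ≈1)))
      (λ i j → expx-at-sym (fromℕ (w i)) (fromℕ (w j)))
      (λ i j → twisted-equation d χ (ξ K.^ w i) (B i) (eq i) (w i) (w j))

-- The identity for fixed n, read off from n-th coefficients

open import Data.Nat.Base using (_*_; _^_)

theorem10 : {c ℓ₁ ℓ₂ c′ ℓ₁′ ℓ₂′ : Level}
    (p : ℕ) (p-prime : Prime p) (T : ℂₚ-Tower p c ℓ₁ ℓ₂) →
    let open Bernoulli T
    in
    (A : AlgebraicClosure ℚ-field c′ ℓ₁′ ℓ₂′) →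
    let ℚ̄ = AlgebraicClosure.closure A
    in
    (emb : HeytingField.Carrier ℚ̄ → K.Carrier) →
    IsFieldHomomorphism ℚ̄ ℂₚ-field emb →
    (d : ℕ) {{d≢0 : NonZero d}} →
    (χ : DirichletCharacter ℚ̄ d) → Primitive ℚ̄ d χ →
    let χₚ = emb ∘ DirichletCharacter.⟦_⟧ χ
    in
    (r : ℕ) {{r≢0 : NonZero r}} → Coprime r (p * d) →
    (ξ : K.Carrier) → ¬ (ξ K.≈ K.1#) → (ξ K.^ r) K.≈ K.1# →
    (w₁ w₂ w₃ : ℕ) {{w₁≢0 : NonZero w₁}} {{w₂≢0 : NonZero w₂}} {{w₃≢0 : NonZero w₃}} →
    r ∤ w₁ → r ∤ w₂ → r ∤ w₃ →
    (B₁ B₂ B₃ : ℕ → Poly) →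
    IsTwistedBernoulli d χₚ (ξ K.^ w₁) B₁ →
    IsTwistedBernoulli d χₚ (ξ K.^ w₂) B₂ →
    IsTwistedBernoulli d χₚ (ξ K.^ w₃) B₃ →
    (n : ℕ) →
    ∑₃ n (λ k l m →
    K[x].const (fromℚ (trinomial k l m))
    K[x].* (B₃ k at w₁ ·y) K[x].* (B₁ l at w₂ ·y) K[x].* (B₂ m at w₃ ·y)
    K[x].* K[x].const (fromℕ (w₃ ^ k * w₁ ^ l * w₂ ^ m)))
    K[x].≈
    ∑₃ n (λ k l m →
    K[x].const (fromℚ (trinomial k l m))
    K[x].* (B₂ k at w₁ ·y) K[x].* (B₁ l at w₃ ·y) K[x].* (B₃ m at w₂ ·y)
    K[x].* K[x].const (fromℕ (w₂ ^ k * w₁ ^ l * w₃ ^ m)))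
theorem10 p _ T _ emb _ d χ _ r _ ξ _ ξʳ≈1 w₁ w₂ w₃ _ _ _ B₁ B₂ B₃ eq₁ eq₂ eq₃ n = begin
  trinomialSum n B₃ B₁ B₂ w₃ w₁ w₂ w₁ w₂ w₃
    ≈⟨ trinomial-convolution n B₃ B₁ B₂ w₃ w₁ w₂ w₁ w₂ w₃ ⟩
  n!ᴾ K[x].* (G 2F 0F K[x]⟦t⟧.* (G 0F 1F K[x]⟦t⟧.* G 1F 2F)) n
    ≈⟨ *-congˡ {n!ᴾ}
         {(G 2F 0F K[x]⟦t⟧.* (G 0F 1F K[x]⟦t⟧.* G 1F 2F)) n}
         {(G 1F 0F K[x]⟦t⟧.* (G 0F 2F K[x]⟦t⟧.* G 2F 1F)) n}
         -- The identity of series is applied at the index n, with `0F`, `1F`, `2F` standing for the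
         -- weights w₁, w₂, w₃.
         (generating-symmetry d (emb ∘ DirichletCharacter.⟦_⟧ χ) r ξ ξʳ≈1 w w≢0 B eq 0F 1F 2F n) ⟩
  n!ᴾ K[x].* (G 1F 0F K[x]⟦t⟧.* (G 0F 2F K[x]⟦t⟧.* G 2F 1F)) n
    ≈⟨ trinomial-convolution n B₂ B₁ B₃ w₂ w₁ w₃ w₁ w₃ w₂ ⟨
  trinomialSum n B₂ B₁ B₃ w₂ w₁ w₃ w₁ w₃ w₂ ∎
  where
  open Bernoulli T
  open TwistedBernoulli T
  open CommutativeRing K[x]-commutativeRing using (setoid; *-congˡ)
  open ≈-Reasoning setoid
  w : Fin 3 → ℕ
  w 0F = w₁
  w 1F = w₂
  w 2F = w₃
  w≢0 : ∀ i → NonZero (w i)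
  w≢0 0F = it
  w≢0 1F = it
  w≢0 2F = it
  B : Fin 3 → ℕ → Poly
  B 0F = B₁
  B 1F = B₂
  B 2F = B₃
  eq : ∀ i → IsTwistedBernoulli d (emb ∘ DirichletCharacter.⟦_⟧ χ) (ξ K.^ w i) (B i)
  eq 0F = eq₁
  eq 1F = eq₂
  eq 2F = eq₃
  G : Fin 3 → Fin 3 → K[x]⟦t⟧.Series
  G i j = generating-at (B i) (w i) (w j)
  n!ᴾ : Poly
  n!ᴾ = κ (ℕ→ℚ (n !))
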